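{- Let $k$ be a positive integer with $k \equiv 4 \pmod 5$ and let \[ n = L_{CC}(10,k) = \frac{512k^5+1280k^4+6400k^3+8640k^2+6890k+757}{3125}. \] Then there is an undirected Cayley graph of the cyclic group $\mathbb{Z}_n$ on five generators which has diameter $k$. Moreover, a generating set for such a graph is \[ \Big\{1,\ \tfrac{32k^3+56k^2+316k+167}{125},\ \tfrac{128k^4+192k^3+1408k^2+1002k+908}{625},\ \tfrac{128k^4+352k^3+1488k^2+2432k+543}{625},\ \tfrac{256k^4+384k^3+2616k^2+1354k+116}{625}\Big\}, \] i.e. the Cayley graph of $\mathbb{Z}_n$ with connection set $\{\pm g_1,\dots,\pm g_5\}$, where $g_1,\dots,g_5$ are these integers taken modulo $n$, has diameter $k$.
   Context: For a positive integer $n$ and integers $g_1,\dots,g_5$, the undirected Cayley (circulant) graph of the cyclic group $\mathbb{Z}_n$ with generating set $\{g_1,\dots,g_5\}$ has vertex set $\mathbb{Z}_n$, with $i$ and $j$ adjacent if and only if $j-i \equiv \pm g_t \pmod n$ for some $t$. Its diameter is the maximum over pairs of vertices of the graph distance. The notation $L_{CC}(10,k)$ is just a name for the displayed polynomial value. -}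

module Defs where

open import Data.Nat using (ℕ; zero; suc; _+_; _*_; _≤_; _%_; _/_)
open import Data.Nat.Divisibility using (_∣_)
open import Data.Fin using (Fin; toℕ)
open import Data.List using (List; _∷_; [])
open import Data.List.Membership.Propositional using (_∈_)
open import Data.Product using (Σ; _×_; ∃; ∃-syntax)
open import Data.Sum using (_⊎_)
open import Relation.Binary.PropositionalEquality using (_≡_)

nNum : ℕ → ℕ
nNum k = 512 * k * k * k * k * k + 1280 * k * k * k * k + 6400 * k * k * k
         + 8640 * k * k + 6890 * k + 757

g2Num g3Num g4Num g5Num : ℕ → ℕ
g2Num k = 32 * k * k * k + 56 * k * k + 316 * k + 167
g3Num k = 128 * k * k * k * k + 192 * k * k * k + 1408 * k * k + 1002 * k + 908
g4Num k = 128 * k * k * k * k + 352 * k * k * k + 1488 * k * k + 2432 * k + 543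
g5Num k = 256 * k * k * k * k + 384 * k * k * k + 2616 * k * k + 1354 * k + 116

-- L_CC(10,k) and the generators (the divisions are exact when k ≡ 4 mod 5;
-- exactness is asserted in the theorem statement).
L-CC10 : ℕ → ℕ
L-CC10 k = nNum k / 3125

gens : ℕ → List ℕ
gens k = 1 ∷ g2Num k / 125 ∷ g3Num k / 625 ∷ g4Num k / 625 ∷ g5Num k / 625 ∷ []

Adj : (n : ℕ) → List ℕ → Fin n → Fin n → Set
Adj zero S ()
Adj (suc n) S i j = ∃[ g ] (g ∈ S × ((toℕ i + g) % suc n ≡ toℕ j % suc n
                                   ⊎ (toℕ j + g) % suc n ≡ toℕ i % suc n))

data Walk (n : ℕ) (S : List ℕ) : ℕ → Fin n → Fin n → Set where
  nil  : ∀ {i} → Walk n S 0 i i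
  cons : ∀ {l i m j} → Adj n S i m → Walk n S l m j → Walk n S (suc l) i j

HasDiameter : (n : ℕ) → List ℕ → ℕ → Set
HasDiameter n S d =
  ((i j : Fin n) → ∃[ l ] (l ≤ d × Walk n S l i j))
  × (∃[ i ] ∃[ j ] ((l : ℕ) → Walk n S l i j → d ≤ l))

{-# OPTIONS --safe #-}

-- Put k = 5m + 4 and let Λ ⊂ ℤ⁵ be the kernel of y ↦ Σ yᵢ gᵢ mod n; the diameter
-- is the covering radius of Λ in the ℓ¹ norm.  Λ is a perturbed body-centred cubic
-- lattice: Λ = L ∪ (w + L), where L is spanned by the rows of V = 4m·I + O(1), whose
-- off-diagonal part is skew-symmetric with entries 0, ±1, and w = ½ Σ V ≈ (2m, …, 2m).
--
-- Upper bound.  Each a ∈ L has, in each of the 32 orthants around it, a neighbour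
-- b ∈ w + L with ‖b − a‖ = 2k + 1.  A point y of the box with opposite corners a, b
-- satisfies ‖y − a‖ + ‖y − b‖ = 2k + 1, hence is within k of a or b.  These boxes
-- cover ℤ⁵.  Subtracting rows of V decreases a weighted norm until y lies in a
-- bounded region; there the covering is a finite case distinction, uniform in m
-- because all walls of the boxes are linear in m.
--
-- Lower bound.  For m ≥ 1, V is so strongly diagonally dominant that no element of L
-- brings `hole`, halfway between 0 and w, or hole − w closer to 0.
module Submission where

open import Defs
open import Algebra.Properties.CommutativeSemigroup using (interchange)
open import Data.Bool using (Bool; true; T; not; _∧_; _∨_)
open import Data.Bool.Properties using (T-∧; T-∨)
open import Data.Fin using (Fin; zero; suc; toℕ; fromℕ<)
open import Data.Fin.Properties using (toℕ-fromℕ<; toℕ-injective; toℕ<n; all?; ¬∀⟶∃¬)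
open import Data.Integer as ℤ using (ℤ; +_; -[1+_]; _+_; _*_; _-_; -_; 0ℤ; 1ℤ; -1ℤ; ∣_∣; _≤_; _≤ᵇ_; _≤?_; +≤+; -≤+)
open import Data.Integer.Divisibility.Signed as ∣ℤ using (divides; ∣⇒∣ᵤ; ∣m∣n⇒∣m+n; ∣m∣n⇒∣m-n; ∣m⇒∣-m; ∣n⇒∣m*n)
open import Data.Integer.DivMod using (_%ℕ_; _/ℕ_; n%ℕd<d; a≡a%ℕn+[a/ℕn]*n)
open import Data.Integer.Properties
open import Data.Integer.Tactic.RingSolver using (solve-∀)
open import Data.List as List using (List; []; _∷_)
open import Data.List.Membership.Propositional using (_∈_)
open import Data.List.Relation.Unary.Any using (here; there)
open import Data.Nat as ℕ using (ℕ; zero; suc; s≤s; z≤n)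
import Data.Nat.Divisibility as ℕ
import Data.Nat.DivMod as ℕ
open import Data.Nat.Induction using (<-wellFounded)
import Data.Nat.Properties as ℕ
open import Data.Nat.Solver using (module +-*-Solver)
import Data.Nat.Tactic.RingSolver as ℕ
open import Data.Product using (_×_; _,_; ∃; proj₁; proj₂)
open import Data.Sum using (_⊎_; inj₁; inj₂; [_,_]′)
open import Data.Unit using (⊤; tt)
open import Data.Vec using (Vec; []; _∷_; zipWith; map; replicate; lookup; tail; toList; _[_]%=_)
open import Data.Vec.Membership.Propositional.Properties using (∈-lookup)
open import Data.Vec.Properties using (lookup-map; map-cong; zipWith-assoc)
open import Data.Vec.Relation.Binary.Pointwise.Inductive using (Pointwise; []; _∷_)
open import Data.Vec.Relation.Unary.All as All using (All; []; _∷_)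
open import Function using (Equivalence)
open import Induction.WellFounded using (Acc; acc)
open import Relation.Binary.PropositionalEquality
open import Relation.Nullary using (¬_; yes; no; contradiction)

-- The number 2k + 1 is half the trace of `V`, and skew-symmetry is what makes all 32 neighbours
-- equally distant. The neighbours of 0 are b = ½ Σ εᵢ Vᵢ with signs εᵢ = ±1. A nonzero entry bⱼ has
-- sign εⱼ, since no diagonal entry of `V` is smaller than the sum of the absolute values of the
-- others in its column. So ‖b‖ = Σ εⱼ bⱼ = ½ Σ εᵢ εⱼ Vᵢⱼ; the off-diagonal terms cancel in pairs,
-- and ½ (20m + 18) = 10m + 9 = 2k + 1 is left. For a diagonal `V` the 32 boxes around 0 would form
-- one large box whose translates by L tile space. The off-diagonal entries shift the corners by
-- O(1), so the boxes overlap in some places and leave thin gaps in others, which boxes at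
-- neighbouring centres must fill. This is why the covering needs a long case distinction. To settle
-- it for all m at once, every bound is a polynomial in m, and polynomials are compared by the signs
-- of their coefficients.

private variable
  n k : ℕ

-- Vectors

infixl 6 _+ᵛ_ _-ᵛ_
infixr 7 _*ᵛ_

_+ᵛ_ _-ᵛ_ : Vec ℤ n → Vec ℤ n → Vec ℤ n
_+ᵛ_ = zipWith _+_
_-ᵛ_ = zipWith _-_

_*ᵛ_ : ℤ → Vec ℤ n → Vec ℤ n
c *ᵛ x = map (c *_) x

0ᵛ : Vec ℤ n
0ᵛ = replicate _ 0ℤ

dot : Vec ℤ n → Vec ℤ n → ℤ
dot []       []       = 0ℤ
dot (x ∷ xs) (y ∷ ys) = x * y + dot xs ys

‖_‖ : Vec ℤ n → ℕ
‖ [] ‖     = 0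
‖ x ∷ xs ‖ = ∣ x ∣ ℕ.+ ‖ xs ‖

private
  distrib₊ : ∀ a b x c d → (a + b) * x + (c + d) ≡ (a * x + c) + (b * x + d)
  distrib₊ = solve-∀
  distrib₋ : ∀ a b x c d → (a - b) * x + (c - d) ≡ (a * x + c) - (b * x + d)
  distrib₋ = solve-∀
  distrib* : ∀ c a x d → (c * a) * x + c * d ≡ c * (a * x + d)
  distrib* = solve-∀

dot-+ : ∀ (x y z : Vec ℤ n) → dot (x +ᵛ y) z ≡ dot x z + dot y z
dot-+ []       []       []       = refl
dot-+ (x ∷ xs) (y ∷ ys) (z ∷ zs) =
  trans (cong (_+_ ((x + y) * z)) (dot-+ xs ys zs)) (distrib₊ x y z (dot xs zs) (dot ys zs))

dot-- : ∀ (x y z : Vec ℤ n) → dot (x -ᵛ y) z ≡ dot x z - dot y z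
dot-- []       []       []       = refl
dot-- (x ∷ xs) (y ∷ ys) (z ∷ zs) =
  trans (cong (_+_ ((x - y) * z)) (dot-- xs ys zs)) (distrib₋ x y z (dot xs zs) (dot ys zs))

dot-* : ∀ c (x z : Vec ℤ n) → dot (c *ᵛ x) z ≡ c * dot x z
dot-* c []       []       = sym (*-zeroʳ c)
dot-* c (x ∷ xs) (z ∷ zs) =
  trans (cong (_+_ ((c * x) * z)) (dot-* c xs zs)) (distrib* c x z (dot xs zs))

dot-0 : ∀ (z : Vec ℤ n) → dot 0ᵛ z ≡ 0ℤ
dot-0 []       = refl
dot-0 (z ∷ zs) = trans (+-identityˡ _) (dot-0 zs)

‖0‖ : ∀ n → ‖ 0ᵛ {n} ‖ ≡ 0
‖0‖ zero    = refl
‖0‖ (suc n) = ‖0‖ n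

ℕ-interchange : ∀ a b c d → (a ℕ.+ b) ℕ.+ (c ℕ.+ d) ≡ (a ℕ.+ c) ℕ.+ (b ℕ.+ d)
ℕ-interchange = interchange ℕ.+-commutativeSemigroup

‖+‖≤ : ∀ (x y : Vec ℤ n) → ‖ x +ᵛ y ‖ ℕ.≤ ‖ x ‖ ℕ.+ ‖ y ‖
‖+‖≤ []       []       = z≤n
‖+‖≤ (x ∷ xs) (y ∷ ys) = begin
  ∣ x + y ∣ ℕ.+ ‖ xs +ᵛ ys ‖                  ≤⟨ ℕ.+-mono-≤ (∣i+j∣≤∣i∣+∣j∣ x y) (‖+‖≤ xs ys) ⟩
  (∣ x ∣ ℕ.+ ∣ y ∣) ℕ.+ (‖ xs ‖ ℕ.+ ‖ ys ‖)   ≡⟨ ℕ-interchange ∣ x ∣ ∣ y ∣ ‖ xs ‖ ‖ ys ‖ ⟩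
  (∣ x ∣ ℕ.+ ‖ xs ‖) ℕ.+ (∣ y ∣ ℕ.+ ‖ ys ‖)   ∎
  where
  open ℕ.≤-Reasoning

-- Cayley graphs of ℤ/n

module _ {N : ℕ} .{{_ : ℕ.NonZero N}} where

  -- `Adj` compares remainders, but ring identities apply to differences in ℤ. Congruence is
  -- therefore carried as divisibility of a difference and translated in both directions.
  %ℕ-injective : ∀ a b → a %ℕ N ≡ b %ℕ N → + N ∣ℤ.∣ a - b
  %ℕ-injective a b eq = divides (a /ℕ N - b /ℕ N) (begin
    a - b                                                    ≡⟨ cong₂ _-_ (a≡a%ℕn+[a/ℕn]*n a N) (a≡a%ℕn+[a/ℕn]*n b N) ⟩
    (+ (a %ℕ N) + a /ℕ N * + N) - (+ (b %ℕ N) + b /ℕ N * + N) ≡⟨ cong (λ r → (+ r + a /ℕ N * + N) - (+ (b %ℕ N) + b /ℕ N * + N)) eq ⟩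
    (+ (b %ℕ N) + a /ℕ N * + N) - (+ (b %ℕ N) + b /ℕ N * + N) ≡⟨ lem (+ (b %ℕ N)) (a /ℕ N) (b /ℕ N) (+ N) ⟩
    (a /ℕ N - b /ℕ N) * + N                                  ∎)
    where
    open ≡-Reasoning
    lem : ∀ r p q d → (r + p * d) - (r + q * d) ≡ (p - q) * d
    lem = solve-∀

  -- Both remainders lie below N, so their difference is a multiple of N of absolute value less than
  -- N, hence 0.
  %ℕ-cong : ∀ a b → + N ∣ℤ.∣ a - b → a %ℕ N ≡ b %ℕ N
  %ℕ-cong a b N∣a-b = +-injective (i-j≡0⇒i≡j (+ r) (+ s) (∣i∣≡0⇒i≡0 (small ∣ + r - + s ∣ ∣r-s∣<N N∣∣r-s∣)))
    where
    r = a %ℕ N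
    s = b %ℕ N
    lem : ∀ r s p q d → r - s ≡ ((r + p * d) - (s + q * d)) - (p - q) * d
    lem = solve-∀
    N∣r-s : + N ∣ℤ.∣ + r - + s
    N∣r-s = subst (+ N ∣ℤ.∣_)
      (sym (trans (lem (+ r) (+ s) (a /ℕ N) (b /ℕ N) (+ N))
        (cong₂ (λ u v → (u - v) - (a /ℕ N - b /ℕ N) * + N)
          (sym (a≡a%ℕn+[a/ℕn]*n a N)) (sym (a≡a%ℕn+[a/ℕn]*n b N)))))
      (∣m∣n⇒∣m-n N∣a-b (divides (a /ℕ N - b /ℕ N) refl))
    N∣∣r-s∣ : N ℕ.∣ ∣ + r - + s ∣
    N∣∣r-s∣ = ∣⇒∣ᵤ N∣r-s
    ∣r-s∣<N : ∣ + r - + s ∣ ℕ.< N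
    ∣r-s∣<N = subst (λ t → ∣ t ∣ ℕ.< N) (sym (m-n≡m⊖n r s))
      (ℕ.≤-<-trans (∣m⊝n∣≤m⊔n r s) (ℕ.⊔-lub (n%ℕd<d a N) (n%ℕd<d b N)))
    small : ∀ d → d ℕ.< N → N ℕ.∣ d → d ≡ 0
    small zero    _   _   = refl
    small (suc d) d<N N∣d = contradiction (ℕ.∣⇒≤ N∣d) (ℕ.<⇒≱ d<N)

-- The order has the form `suc N′` because `Adj` computes only on successors.
module Circulant (N′ : ℕ) where

  private
    N = suc N′

  -- Vertices are named by arbitrary integers, so that a walk can be followed in ℤ without reducing
  -- after each step.
  vertex : ℤ → Fin N
  vertex z = fromℕ< (n%ℕd<d z N)

  toℕ-vertex : ∀ z → + N ∣ℤ.∣ + toℕ (vertex z) - z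
  toℕ-vertex z = %ℕ-injective (+ toℕ (vertex z)) z
    (trans (cong (ℕ._% N) (toℕ-fromℕ< (n%ℕd<d z N))) (ℕ.m<n⇒m%n≡m (n%ℕd<d z N)))

  vertex-cong : ∀ a b → + N ∣ℤ.∣ a - b → vertex a ≡ vertex b
  vertex-cong a b N∣a-b = toℕ-injective (begin
    toℕ (vertex a) ≡⟨ toℕ-fromℕ< (n%ℕd<d a N) ⟩
    a %ℕ N         ≡⟨ %ℕ-cong a b N∣a-b ⟩
    b %ℕ N         ≡⟨ sym (toℕ-fromℕ< (n%ℕd<d b N)) ⟩
    toℕ (vertex b) ∎)
    where open ≡-Reasoning

  vertex-toℕ : ∀ i → vertex (+ toℕ i) ≡ i
  vertex-toℕ i = toℕ-injective (trans (toℕ-fromℕ< (n%ℕd<d (+ toℕ i) N)) (ℕ.m<n⇒m%n≡m (toℕ<n i)))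

  private
    shift : ∀ a b z g → (a - z) - (b - (z + g)) ≡ (a + g) - b
    shift = solve-∀
    shift′ : ∀ a b z g → (b - (z - g)) - (a - z) ≡ (b + g) - a
    shift′ = solve-∀

  adjacent₊ : ∀ {S g} → g ∈ S → ∀ z → Adj N S (vertex z) (vertex (z + + g))
  adjacent₊ {g = g} g∈S z = g , g∈S , inj₁
    (%ℕ-cong (+ (toℕ i ℕ.+ g)) (+ toℕ j)
      (subst (+ N ∣ℤ.∣_) (shift (+ toℕ i) (+ toℕ j) z (+ g))
        (∣m∣n⇒∣m-n (toℕ-vertex z) (toℕ-vertex (z + + g)))))
    where
    i = vertex z
    j = vertex (z + + g)

  adjacent₋ : ∀ {S g} → g ∈ S → ∀ z → Adj N S (vertex z) (vertex (z - + g))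
  adjacent₋ {g = g} g∈S z = g , g∈S , inj₂
    (%ℕ-cong (+ (toℕ j ℕ.+ g)) (+ toℕ i)
      (subst (+ N ∣ℤ.∣_) (shift′ (+ toℕ i) (+ toℕ j) z (+ g))
        (∣m∣n⇒∣m-n (toℕ-vertex (z - + g)) (toℕ-vertex z))))
    where
    i = vertex z
    j = vertex (z - + g)

  _++ʷ_ : ∀ {S l l′ i j m} → Walk N S l i j → Walk N S l′ j m → Walk N S (l ℕ.+ l′) i m
  nil      ++ʷ w′ = w′
  cons a w ++ʷ w′ = cons a (w ++ʷ w′)

  private
    step-assoc : ∀ z d r → (z + d) + r * d ≡ z + (1ℤ + r) * d
    step-assoc = solve-∀
    z+0*d : ∀ z d → z ≡ z + 0ℤ * d
    z+0*d = solve-∀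
    neg-swap : ∀ x d → x * - d ≡ - x * d
    neg-swap = solve-∀

  iterate : ∀ {S} d → (∀ z → Adj N S (vertex z) (vertex (z + d))) →
            ∀ r z → Walk N S r (vertex z) (vertex (z + + r * d))
  iterate d adj zero    z = subst (λ t → Walk N _ 0 (vertex z) (vertex t)) (z+0*d z d) nil
  iterate d adj (suc r) z = cons (adj z)
    (subst (λ t → Walk N _ r (vertex (z + d)) (vertex t)) (step-assoc z d (+ r)) (iterate d adj r (z + d)))

  line : ∀ {S g} → g ∈ S → ∀ x z → Walk N S ∣ x ∣ (vertex z) (vertex (z + x * + g))
  line         g∈S (+ r)    z = iterate _ (adjacent₊ g∈S) r z
  line {g = g} g∈S -[1+ r ] z = subst (λ t → Walk N _ (suc r) (vertex z) (vertex (z + t)))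
    (neg-swap (+ suc r) (+ g)) (iterate (- + g) (adjacent₋ g∈S) (suc r) z)

  -- The steps are taken generator by generator. `S` is separate from `gs` because the induction
  -- shortens `gs` while the connection set of the graph stays the same.
  path : ∀ {S} {gs : Vec ℕ n} → All (_∈ S) gs → ∀ y z →
         Walk N S ‖ y ‖ (vertex z) (vertex (z + dot y (map +_ gs)))
  path                []           []      z =
    subst (λ t → Walk N _ 0 (vertex z) (vertex t)) (sym (+-identityʳ z)) nil
  path {gs = g ∷ gs} (g∈S ∷ gs⊆S) (x ∷ y) z =
    line g∈S x z ++ʷ subst (λ t → Walk N _ ‖ y ‖ (vertex (z + x * + g)) (vertex t))
      (+-assoc z (x * + g) (dot y (map +_ gs))) (path gs⊆S y (z + x * + g))

  toList-⊇ : ∀ (gs : Vec ℕ n) → All (_∈ toList gs) gs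
  toList-⊇ []       = []
  toList-⊇ (g ∷ gs) = here refl ∷ All.map there (toList-⊇ gs)

  vector⇒walk : ∀ (gs : Vec ℕ n) y i j →
                + N ∣ℤ.∣ dot y (map +_ gs) - (+ toℕ j - + toℕ i) →
                Walk N (toList gs) ‖ y ‖ i j
  vector⇒walk gs y i j N∣ =
    subst₂ (Walk N (toList gs) ‖ y ‖) (vertex-toℕ i)
      (trans (vertex-cong (+ toℕ i + dot y (map +_ gs)) (+ toℕ j) (subst (+ N ∣ℤ.∣_) (lem (dot y (map +_ gs)) (+ toℕ i) (+ toℕ j)) N∣)) (vertex-toℕ j))
      (path (toList-⊇ gs) y (+ toℕ i))
    where
    lem : ∀ d i j → d - (j - i) ≡ (i + d) - j
    lem = solve-∀

  single : ∀ s {g} (gs : Vec ℕ n) → g ∈ toList gs →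
           ∃ λ e → ‖ e ‖ ≡ ∣ s ∣ × dot e (map +_ gs) ≡ s * + g
  single {suc n} s (g ∷ gs) (here refl) = s ∷ 0ᵛ
    , trans (cong (∣ s ∣ ℕ.+_) (‖0‖ n)) (ℕ.+-identityʳ ∣ s ∣)
    , trans (cong (_+_ (s * + g)) (dot-0 (map +_ gs))) (+-identityʳ (s * + g))
  single s (g ∷ gs) (there g∈gs) with single s gs g∈gs
  ... | e , ‖e‖≡ , dot≡ = 0ℤ ∷ e , ‖e‖≡ , trans (+-identityˡ (dot e (map +_ gs))) dot≡

  adjacent⇒single : ∀ (gs : Vec ℕ n) {i j} → Adj N (toList gs) i j →
                    ∃ λ e → ‖ e ‖ ≡ 1 × + N ∣ℤ.∣ dot e (map +_ gs) - (+ toℕ j - + toℕ i)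
  adjacent⇒single gs {i} {j} (g , g∈gs , inj₁ eq) with single 1ℤ gs g∈gs
  ... | e , ‖e‖≡1 , dot≡ = e , ‖e‖≡1 ,
    subst (+ N ∣ℤ.∣_) (trans (lem (+ toℕ i) (+ toℕ j) (+ g)) (cong (_- (+ toℕ j - + toℕ i)) (sym dot≡)))
      (%ℕ-injective (+ (toℕ i ℕ.+ g)) (+ toℕ j) eq)
    where
    lem : ∀ i j g → (i + g) - j ≡ 1ℤ * g - (j - i)
    lem = solve-∀
  adjacent⇒single gs {i} {j} (g , g∈gs , inj₂ eq) with single (-1ℤ) gs g∈gs
  ... | e , ‖e‖≡1 , dot≡ = e , ‖e‖≡1 ,
    subst (+ N ∣ℤ.∣_) (trans (lem (+ toℕ i) (+ toℕ j) (+ g)) (cong (_- (+ toℕ j - + toℕ i)) (sym dot≡)))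
      (∣m⇒∣-m (%ℕ-injective (+ (toℕ j ℕ.+ g)) (+ toℕ i) eq))
    where
    lem : ∀ i j g → - ((j + g) - i) ≡ -1ℤ * g - (j - i)
    lem = solve-∀

  -- Every edge contributes a signed unit vector. Opposite steps cancel, hence only an inequality
  -- for the norm. Together with `vector⇒walk` this identifies graph distance with the least ℓ¹ norm
  -- in a coset of Λ.
  walk⇒vector : ∀ (gs : Vec ℕ n) {l i j} → Walk N (toList gs) l i j →
                ∃ λ y → ‖ y ‖ ℕ.≤ l × + N ∣ℤ.∣ dot y (map +_ gs) - (+ toℕ j - + toℕ i)
  walk⇒vector {n} gs {i = i} nil = 0ᵛ , ℕ.≤-reflexive (‖0‖ n)
    , divides 0ℤ (trans (cong (_- (+ toℕ i - + toℕ i)) (dot-0 (map +_ gs))) (lem (+ toℕ i)))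
    where
    lem : ∀ i → 0ℤ - (i - i) ≡ 0ℤ
    lem = solve-∀
  walk⇒vector gs {i = i} {j} (cons {m = m} a w) with adjacent⇒single gs {i} {m} a | walk⇒vector gs w
  ... | e , ‖e‖≡1 , N∣e | y , ‖y‖≤l , N∣y = e +ᵛ y
    , ℕ.≤-trans (‖+‖≤ e y) (ℕ.+-mono-≤ (ℕ.≤-reflexive ‖e‖≡1) ‖y‖≤l)
    , subst (+ N ∣ℤ.∣_)
        (trans (lem (dot e (map +_ gs)) (dot y (map +_ gs)) (+ toℕ i) (+ toℕ m) (+ toℕ j))
          (cong (_- (+ toℕ j - + toℕ i)) (sym (dot-+ e y (map +_ gs)))))
        (∣m∣n⇒∣m+n N∣e N∣y)
    where
    lem : ∀ d e i m j → (d - (m - i)) + (e - (j - m)) ≡ (d + e) - (j - i)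
    lem = solve-∀

-- Integer combinations of vectors

comb : Vec ℤ k → Vec (Vec ℤ n) k → Vec ℤ n
comb []       []       = 0ᵛ
comb (c ∷ cs) (r ∷ rs) = c *ᵛ r +ᵛ comb cs rs

∣-dot-comb : ∀ {d} {g : Vec ℤ n} {rs : Vec (Vec ℤ n) k} →
             All (λ r → d ∣ℤ.∣ dot r g) rs → ∀ cs → d ∣ℤ.∣ dot (comb cs rs) g
∣-dot-comb {d = d} {g}              []         []       = divides 0ℤ (dot-0 g)
∣-dot-comb {d = d} {g} {rs = r ∷ rs} (d∣r ∷ d∣rs) (c ∷ cs) =
  subst (d ∣ℤ.∣_) (sym (trans (dot-+ (c *ᵛ r) (comb cs rs) g) (cong (_+ dot (comb cs rs) g) (dot-* c r g))))
    (∣m∣n⇒∣m+n (∣n⇒∣m*n c d∣r) (∣-dot-comb d∣rs cs))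

-- Polynomials with integer coefficients, constant term first

Poly : Set
Poly = List ℤ

⟦_⟧ : Poly → ℕ → ℤ
⟦ [] ⟧    m = 0ℤ
⟦ c ∷ p ⟧ m = c + + m * ⟦ p ⟧ m

infixl 6 _⊕_ _⊖_
infixl 7 _⊗_
infixr 7 _⊙_

_⊕_ : Poly → Poly → Poly
[]      ⊕ q       = q
(c ∷ p) ⊕ []      = c ∷ p
(c ∷ p) ⊕ (d ∷ q) = c + d ∷ p ⊕ q

_⊙_ : ℤ → Poly → Poly
c ⊙ p = List.map (c *_) p

_⊖_ : Poly → Poly → Poly
p ⊖ q = p ⊕ -1ℤ ⊙ q

_⊗_ : Poly → Poly → Poly
[]      ⊗ q = []
(c ∷ p) ⊗ q = c ⊙ q ⊕ (0ℤ ∷ p ⊗ q)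

⟦⊕⟧ : ∀ p q m → ⟦ p ⊕ q ⟧ m ≡ ⟦ p ⟧ m + ⟦ q ⟧ m
⟦⊕⟧ []      q       m = sym (+-identityˡ (⟦ q ⟧ m))
⟦⊕⟧ (c ∷ p) []      m = sym (+-identityʳ (⟦ c ∷ p ⟧ m))
⟦⊕⟧ (c ∷ p) (d ∷ q) m =
  trans (cong (λ t → (c + d) + + m * t) (⟦⊕⟧ p q m)) (lem c d (+ m) (⟦ p ⟧ m) (⟦ q ⟧ m))
  where
  lem : ∀ c d m p q → (c + d) + m * (p + q) ≡ (c + m * p) + (d + m * q)
  lem = solve-∀

⟦⊙⟧ : ∀ c p m → ⟦ c ⊙ p ⟧ m ≡ c * ⟦ p ⟧ m
⟦⊙⟧ c []      m = sym (*-zeroʳ c)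
⟦⊙⟧ c (d ∷ p) m = trans (cong (λ t → c * d + + m * t) (⟦⊙⟧ c p m)) (lem c d (+ m) (⟦ p ⟧ m))
  where
  lem : ∀ c d m p → c * d + m * (c * p) ≡ c * (d + m * p)
  lem = solve-∀

⟦⊖⟧ : ∀ p q m → ⟦ p ⊖ q ⟧ m ≡ ⟦ p ⟧ m - ⟦ q ⟧ m
⟦⊖⟧ p q m = trans (⟦⊕⟧ p (-1ℤ ⊙ q) m)
  (cong (_+_ (⟦ p ⟧ m)) (trans (⟦⊙⟧ (-1ℤ) q m) (-1*i≡-i (⟦ q ⟧ m))))

⟦⊗⟧ : ∀ p q m → ⟦ p ⊗ q ⟧ m ≡ ⟦ p ⟧ m * ⟦ q ⟧ m
⟦⊗⟧ []      q m = refl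
⟦⊗⟧ (c ∷ p) q m = begin
  ⟦ c ⊙ q ⊕ (0ℤ ∷ p ⊗ q) ⟧ m                     ≡⟨ ⟦⊕⟧ (c ⊙ q) (0ℤ ∷ p ⊗ q) m ⟩
  ⟦ c ⊙ q ⟧ m + (0ℤ + + m * ⟦ p ⊗ q ⟧ m)         ≡⟨ cong₂ (λ s t → s + (0ℤ + + m * t)) (⟦⊙⟧ c q m) (⟦⊗⟧ p q m) ⟩
  c * ⟦ q ⟧ m + (0ℤ + + m * (⟦ p ⟧ m * ⟦ q ⟧ m)) ≡⟨ lem c (+ m) (⟦ p ⟧ m) (⟦ q ⟧ m) ⟩
  (c + + m * ⟦ p ⟧ m) * ⟦ q ⟧ m                  ∎
  where
  open ≡-Reasoning
  lem : ∀ c m p q → c * q + (0ℤ + m * (p * q)) ≡ (c + m * p) * q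
  lem = solve-∀

-- A test that implies nonnegativity for every natural m. For linear polynomials, such as the walls
-- of the boxes, it is also necessary: look at m = 0 and at large m.
nonNegᵇ : Poly → Bool
nonNegᵇ []      = true
nonNegᵇ (c ∷ p) = (0ℤ ≤ᵇ c) ∧ nonNegᵇ p

infix 4 _≼_ _≅_

-- Two inequalities, rather than a comparison of lists, make `_≅_` blind to the trailing zeros that
-- the operations leave behind.
_≼_ _≅_ : Poly → Poly → Bool
p ≼ q = nonNegᵇ (q ⊖ p)
p ≅ q = (p ≼ q) ∧ (q ≼ p)

∧-elim : ∀ {x y} → T (x ∧ y) → T x × T y
∧-elim = Equivalence.to T-∧

nonNeg-sound : ∀ p {m} → T (nonNegᵇ p) → 0ℤ ≤ ⟦ p ⟧ m
nonNeg-sound []      _  = ≤-refl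
nonNeg-sound (c ∷ p) {m} t with ∧-elim {0ℤ ≤ᵇ c} t
... | 0≤c , 0≤p = +-mono-≤ {0ℤ} {c} (≤ᵇ⇒≤ 0≤c)
  (subst (_≤ + m * ⟦ p ⟧ m) (*-zeroʳ (+ m)) (*-monoˡ-≤-nonNeg (+ m) (nonNeg-sound p {m} 0≤p)))

≼-sound : ∀ p q {m} → T (p ≼ q) → ⟦ p ⟧ m ≤ ⟦ q ⟧ m
≼-sound p q {m} p≼q = 0≤i-j⇒j≤i (subst (0ℤ ≤_) (⟦⊖⟧ q p m) (nonNeg-sound (q ⊖ p) p≼q))

≅-sound : ∀ p q {m} → T (p ≅ q) → ⟦ p ⟧ m ≡ ⟦ q ⟧ m
≅-sound p q p≅q with ∧-elim {p ≼ q} p≅q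
... | p≼q , q≼p = ≤-antisym (≼-sound p q p≼q) (≼-sound q p q≼p)

⟦const⟧ : ∀ c m → ⟦ c ∷ [] ⟧ m ≡ c
⟦const⟧ c m = lem c (+ m)
  where
  lem : ∀ c m → c + m * 0ℤ ≡ c
  lem = solve-∀

⟦_⟧ᵛ : Vec Poly n → ℕ → Vec ℤ n
⟦ ps ⟧ᵛ m = map (λ p → ⟦ p ⟧ m) ps

⟦_⟧ᴹ : Vec (Vec Poly n) k → ℕ → Vec (Vec ℤ n) k
⟦ R ⟧ᴹ m = map (λ r → ⟦ r ⟧ᵛ m) R

dotᴾ : Vec Poly n → Vec Poly n → Poly
dotᴾ []       []       = []
dotᴾ (p ∷ ps) (q ∷ qs) = p ⊗ q ⊕ dotᴾ ps qs

⟦dotᴾ⟧ : ∀ (ps qs : Vec Poly n) m → ⟦ dotᴾ ps qs ⟧ m ≡ dot (⟦ ps ⟧ᵛ m) (⟦ qs ⟧ᵛ m)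
⟦dotᴾ⟧ []       []       m = refl
⟦dotᴾ⟧ (p ∷ ps) (q ∷ qs) m =
  trans (⟦⊕⟧ (p ⊗ q) (dotᴾ ps qs) m) (cong₂ _+_ (⟦⊗⟧ p q m) (⟦dotᴾ⟧ ps qs m))

infixl 6 _⊕ᵛ_

_⊕ᵛ_ : Vec Poly n → Vec Poly n → Vec Poly n
_⊕ᵛ_ = zipWith _⊕_

⟦⊕ᵛ⟧ : ∀ (ps qs : Vec Poly n) m → ⟦ ps ⊕ᵛ qs ⟧ᵛ m ≡ ⟦ ps ⟧ᵛ m +ᵛ ⟦ qs ⟧ᵛ m
⟦⊕ᵛ⟧ []       []       m = refl
⟦⊕ᵛ⟧ (p ∷ ps) (q ∷ qs) m = cong₂ _∷_ (⟦⊕⟧ p q m) (⟦⊕ᵛ⟧ ps qs m)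

⟦0⟧ᵛ : ∀ n m → ⟦ replicate n [] ⟧ᵛ m ≡ 0ᵛ
⟦0⟧ᵛ zero    m = refl
⟦0⟧ᵛ (suc n) m = cong (0ℤ ∷_) (⟦0⟧ᵛ n m)

combᴾ : Vec Poly k → Vec (Vec Poly n) k → Vec Poly n
combᴾ []       []       = replicate _ []
combᴾ (c ∷ cs) (r ∷ rs) = map (c ⊗_) r ⊕ᵛ combᴾ cs rs

⟦combᴾ⟧ : ∀ (cs : Vec Poly k) (R : Vec (Vec Poly n) k) m →
          ⟦ combᴾ cs R ⟧ᵛ m ≡ comb (⟦ cs ⟧ᵛ m) (⟦ R ⟧ᴹ m)
⟦combᴾ⟧ []       []       m = ⟦0⟧ᵛ _ m
⟦combᴾ⟧ (c ∷ cs) (r ∷ R) m =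
  trans (⟦⊕ᵛ⟧ (map (c ⊗_) r) (combᴾ cs R) m) (cong₂ _+ᵛ_ (scale r) (⟦combᴾ⟧ cs R m))
  where
  scale : ∀ {n} (r : Vec Poly n) → ⟦ map (c ⊗_) r ⟧ᵛ m ≡ ⟦ c ⟧ m *ᵛ ⟦ r ⟧ᵛ m
  scale []      = refl
  scale (p ∷ r) = cong₂ _∷_ (⟦⊗⟧ c p m) (scale r)

-- Boxes with polynomial bounds

Box : ℕ → Set
Box n = Vec (Poly × Poly) n

Between : ℕ → ℤ → Poly × Poly → Set
Between m y (lo , hi) = ⟦ lo ⟧ m ≤ y × y ≤ ⟦ hi ⟧ m

Inside : ℕ → Vec ℤ n → Box n → Set
Inside m = Pointwise (Between m)

-- A certificate: the cuts subdivide a box, and each leaf carries the witness for its part. The type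
-- of witnesses is a parameter because one kind of tree serves both for covering `cube` and for
-- moving `region` into it.
data Tree (A : Set) (n : ℕ) : Set where
  leaf : A → Tree A n
  cut  : Fin n → Poly → Tree A n → Tree A n → Tree A n

-- Coordinates are integers, so y < t becomes y ≤ t - 1. The old bound is simply overwritten;
-- soundness does not ask that t lie between the old bounds.
below above : Poly → Poly × Poly → Poly × Poly
below t (lo , hi) = lo , t ⊖ (1ℤ ∷ [])
above t (lo , hi) = t , hi

check : ∀ {A} → (Box n → A → Bool) → Tree A n → Box n → Bool
check ok (leaf a)      Q = ok Q a
check ok (cut i t l r) Q = check ok l (Q [ i ]%= below t) ∧ check ok r (Q [ i ]%= above t)

cut-inside : ∀ {m y} {Q : Box n} i t → Inside m y Q →
             Inside m y (Q [ i ]%= below t) ⊎ Inside m y (Q [ i ]%= above t)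
cut-inside {m = m} {y ∷ _} {(lo , hi) ∷ Q} zero t ((lo≤y , y≤hi) ∷ ys) with ⟦ t ⟧ m ≤? y
... | yes t≤y = inj₂ ((t≤y , y≤hi) ∷ ys)
... | no  t≰y = inj₁ ((lo≤y , subst (y ≤_) eq (i<j⇒i≤pred[j] (≰⇒> t≰y))) ∷ ys)
  where
  lem : ∀ t m → -1ℤ + t ≡ t - (1ℤ + m * 0ℤ)
  lem = solve-∀
  eq : ℤ.pred (⟦ t ⟧ m) ≡ ⟦ t ⊖ (1ℤ ∷ []) ⟧ m
  eq = trans (lem (⟦ t ⟧ m) (+ m)) (sym (⟦⊖⟧ t (1ℤ ∷ []) m))
cut-inside (suc i) t (y ∷ ys) with cut-inside i t ys
... | inj₁ ys′ = inj₁ (y ∷ ys′)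
... | inj₂ ys′ = inj₂ (y ∷ ys′)

check-sound : ∀ {A} {ok : Box n → A → Bool} {m y} {G : Set} →
              (∀ Q a → T (ok Q a) → Inside m y Q → G) →
              ∀ t Q → T (check ok t Q) → Inside m y Q → G
check-sound sound (leaf a)      Q c y∈Q = sound Q a c y∈Q
check-sound {ok = ok} sound (cut i t l r) Q c y∈Q with ∧-elim {check ok l _} c | cut-inside i t y∈Q
... | cˡ , _  | inj₁ y∈ = check-sound sound l (Q [ i ]%= below t) cˡ y∈
... | _  , cʳ | inj₂ y∈ = check-sound sound r (Q [ i ]%= above t) cʳ y∈

-- `r` is what remains of the allowed ℓ¹ distance between the two corners. The disjunction allows
-- either corner to be the lower one in a given coordinate.
withinᵇ : Box n → Vec Poly n → Vec Poly n → Poly → Bool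
withinᵇ []             []       []       r = nonNegᵇ r
withinᵇ ((lo , hi) ∷ Q) (a ∷ as) (b ∷ bs) r =
  (((a ≼ lo) ∧ (hi ≼ b)) ∧ withinᵇ Q as bs (r ⊖ (b ⊖ a)))
  ∨ (((b ≼ lo) ∧ (hi ≼ a)) ∧ withinᵇ Q as bs (r ⊖ (a ⊖ b)))

between-sum : ∀ {a b y} → a ≤ y → y ≤ b → + ∣ y - a ∣ + + ∣ y - b ∣ ≡ b - a
between-sum {a} {b} {y} a≤y y≤b = begin
  + ∣ y - a ∣ + + ∣ y - b ∣ ≡⟨ cong₂ _+_ (trans (cong +_ (∣i-j∣≡∣j-i∣ y a)) (∣-∣-≤ a≤y)) (∣-∣-≤ y≤b) ⟩
  (y - a) + (b - y)         ≡⟨ lem y a b ⟩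
  b - a                     ∎
  where
  open ≡-Reasoning
  lem : ∀ y a b → (y - a) + (b - y) ≡ b - a
  lem = solve-∀

-- A point that lies between two corners in every coordinate is on an ℓ¹ geodesic joining them, so
-- its distances to them add up to the distance of the corners.
within-sound : ∀ {m} {y : Vec ℤ n} {Q} as bs r → T (withinᵇ Q as bs r) → Inside m y Q →
               + ‖ y -ᵛ ⟦ as ⟧ᵛ m ‖ + + ‖ y -ᵛ ⟦ bs ⟧ᵛ m ‖ ≤ ⟦ r ⟧ m
within-sound {Q = []} [] [] r t [] = nonNeg-sound r t
within-sound {m = m} {y ∷ ys} {Q = (lo , hi) ∷ Q} (a ∷ as) (b ∷ bs) r t ((lo≤y , y≤hi) ∷ ys∈Q) =
  [ (λ t → go a b t (λ a≤y y≤b → between-sum a≤y y≤b))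
  , (λ t → go b a t (λ b≤y y≤a → trans (+-comm (+ ∣ y - ⟦ a ⟧ m ∣) (+ ∣ y - ⟦ b ⟧ m ∣)) (between-sum b≤y y≤a)))
  ]′ (Equivalence.to T-∨ t)
  where
  A′ = + ∣ y - ⟦ a ⟧ m ∣
  B′ = + ∣ y - ⟦ b ⟧ m ∣
  S  = + ‖ ys -ᵛ ⟦ as ⟧ᵛ m ‖
  S′ = + ‖ ys -ᵛ ⟦ bs ⟧ᵛ m ‖
  swap : ∀ a s b s′ → (a + s) + (b + s′) ≡ (a + b) + (s + s′)
  swap = solve-∀
  cancel : ∀ d r → d + (r - d) ≡ r
  cancel = solve-∀
  go : ∀ p q → T (((p ≼ lo) ∧ (hi ≼ q)) ∧ withinᵇ Q as bs (r ⊖ (q ⊖ p))) →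
       (⟦ p ⟧ m ≤ y → y ≤ ⟦ q ⟧ m → A′ + B′ ≡ ⟦ q ⟧ m - ⟦ p ⟧ m) →
       (A′ + S) + (B′ + S′) ≤ ⟦ r ⟧ m
  go p q t sum with ∧-elim {(p ≼ lo) ∧ (hi ≼ q)} t
  ... | pq , w with ∧-elim {p ≼ lo} pq
  ... | p≼lo , hi≼q = begin
    (A′ + S) + (B′ + S′)                        ≡⟨ swap A′ S B′ S′ ⟩
    (A′ + B′) + (S + S′)                        ≤⟨ +-monoʳ-≤ (A′ + B′) (within-sound as bs (r ⊖ (q ⊖ p)) w ys∈Q) ⟩
    (A′ + B′) + ⟦ r ⊖ (q ⊖ p) ⟧ m               ≡⟨ cong₂ _+_ (sum (≤-trans (≼-sound p lo p≼lo) lo≤y) (≤-trans y≤hi (≼-sound hi q hi≼q)))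
                                                     (trans (⟦⊖⟧ r (q ⊖ p) m) (cong (_-_ (⟦ r ⟧ m)) (⟦⊖⟧ q p m))) ⟩
    (⟦ q ⟧ m - ⟦ p ⟧ m) + (⟦ r ⟧ m - (⟦ q ⟧ m - ⟦ p ⟧ m)) ≡⟨ cancel (⟦ q ⟧ m - ⟦ p ⟧ m) (⟦ r ⟧ m) ⟩
    ⟦ r ⟧ m                                     ∎
    where open ≤-Reasoning

translateᵇ : Box n → Vec Poly n → Box n → Bool
translateᵇ []              []       []              = true
translateᵇ ((lo , hi) ∷ Q) (a ∷ as) ((lo′ , hi′) ∷ P) =
  ((lo′ ⊕ a ≼ lo) ∧ (hi ≼ hi′ ⊕ a)) ∧ translateᵇ Q as P

translate-sound : ∀ {m} {y : Vec ℤ n} {Q} as P → T (translateᵇ Q as P) → Inside m y Q →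
                  Inside m (y -ᵛ ⟦ as ⟧ᵛ m) P
translate-sound {Q = []} [] [] _ [] = []
translate-sound {m = m} {y ∷ _} {(lo , hi) ∷ Q} (a ∷ as) ((lo′ , hi′) ∷ P) t ((lo≤y , y≤hi) ∷ ys)
  with ∧-elim {(lo′ ⊕ a ≼ lo) ∧ (hi ≼ hi′ ⊕ a)} t
... | t₁ , t₂ with ∧-elim {lo′ ⊕ a ≼ lo} t₁
... | l , h = (lower , upper) ∷ translate-sound as P t₂ ys
  where
  lem : ∀ p a → (p + a) - a ≡ p
  lem = solve-∀
  lower : ⟦ lo′ ⟧ m ≤ y - ⟦ a ⟧ m
  lower = subst (_≤ y - ⟦ a ⟧ m) (trans (cong (_- ⟦ a ⟧ m) (⟦⊕⟧ lo′ a m)) (lem (⟦ lo′ ⟧ m) (⟦ a ⟧ m)))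
    (+-monoˡ-≤ (- ⟦ a ⟧ m) (≤-trans (≼-sound (lo′ ⊕ a) lo l) lo≤y))
  upper : y - ⟦ a ⟧ m ≤ ⟦ hi′ ⟧ m
  upper = subst (y - ⟦ a ⟧ m ≤_) (trans (cong (_- ⟦ a ⟧ m) (⟦⊕⟧ hi′ a m)) (lem (⟦ hi′ ⟧ m) (⟦ a ⟧ m)))
    (+-monoˡ-≤ (- ⟦ a ⟧ m) (≤-trans y≤hi (≼-sound hi (hi′ ⊕ a) h)))

-- The lattice

pos : List ℕ → Poly
pos p = List.map +_ p

evalℕ : List ℕ → ℕ → ℕ
evalℕ []      m = 0
evalℕ (c ∷ p) m = m ℕ.* evalℕ p m ℕ.+ c

diagᴾ : ∀ {n} → Vec Poly n → Vec (Vec Poly n) n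
diagᴾ []       = []
diagᴾ (d ∷ ds) = (d ∷ replicate _ []) ∷ map ([] ∷_) (diagᴾ ds)

offDiagonal : Vec (Vec ℤ 5) 5
offDiagonal =
  (0ℤ  ∷ 1ℤ  ∷ -1ℤ ∷ -1ℤ ∷ 1ℤ  ∷ []) ∷
  (-1ℤ ∷ 0ℤ  ∷ 1ℤ  ∷ 0ℤ  ∷ -1ℤ ∷ []) ∷
  (1ℤ  ∷ -1ℤ ∷ 0ℤ  ∷ 1ℤ  ∷ 0ℤ  ∷ []) ∷
  (1ℤ  ∷ 0ℤ  ∷ -1ℤ ∷ 0ℤ  ∷ 0ℤ  ∷ []) ∷
  (-1ℤ ∷ 1ℤ  ∷ 0ℤ  ∷ 0ℤ  ∷ 0ℤ  ∷ []) ∷ []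

diagonal : Vec (List ℕ) 5
diagonal = (4 ∷ 4 ∷ []) ∷ (3 ∷ 4 ∷ []) ∷ (3 ∷ 4 ∷ []) ∷ (4 ∷ 4 ∷ []) ∷ (4 ∷ 4 ∷ []) ∷ []

-- Built as a sum because the lower bound plays the diagonal part against the constant part.
V : Vec (Vec Poly 5) 5
V = zipWith _⊕ᵛ_ (diagᴾ (map pos diagonal)) (map (map (_∷ [])) offDiagonal)

w : Vec Poly 5
w = (+ 2 ∷ + 2 ∷ []) ∷ (+ 2 ∷ + 2 ∷ []) ∷ (+ 1 ∷ + 2 ∷ []) ∷ (+ 2 ∷ + 2 ∷ []) ∷ (+ 2 ∷ + 2 ∷ []) ∷ []

-- The coefficients of a lattice vector are written as one decimal numeral: its
-- digits, least significant first and decreased by 5.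
digits : ∀ n → ℕ → Vec Poly n
digits zero    c = []
digits (suc n) c = ((c ℕ.% 10 ℤ.⊖ 5) ∷ []) ∷ digits n (c ℕ./ 10)

centre corner : ℕ → Vec Poly 5
centre c = combᴾ (digits 5 c) V
corner c = w ⊕ᵛ combᴾ (digits 5 c) V

-- Certificates for the coverings

pattern y₁ = zero
pattern y₂ = suc zero
pattern y₃ = suc (suc zero)
pattern y₄ = suc (suc (suc zero))
pattern y₅ = suc (suc (suc (suc zero)))

pattern box c d = leaf (c , d)

-2m-2 -2m-1 -2m -2m+1 c-3 c-1 c0 c1 c2 c3 2m 2m+1 2m+2 2m+3 : Poly
-2m-2 = -[1+ 1 ] ∷ -[1+ 1 ] ∷ []
-2m-1 = -[1+ 0 ] ∷ -[1+ 1 ] ∷ []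
-2m = + 0 ∷ -[1+ 1 ] ∷ []
-2m+1 = + 1 ∷ -[1+ 1 ] ∷ []
c-3 = -[1+ 2 ] ∷ + 0 ∷ []
c-1 = -[1+ 0 ] ∷ + 0 ∷ []
c0 = + 0 ∷ + 0 ∷ []
c1 = + 1 ∷ + 0 ∷ []
c2 = + 2 ∷ + 0 ∷ []
c3 = + 3 ∷ + 0 ∷ []
2m = + 0 ∷ + 2 ∷ []
2m+1 = + 1 ∷ + 2 ∷ []
2m+2 = + 2 ∷ + 2 ∷ []
2m+3 = + 3 ∷ + 2 ∷ []

-- The first five levels fix the signs of the coordinates. The natural box then joins the origin,
-- 55555, to the corner of that orthant, whose numeral has a 4 for each negative coordinate and a 5
-- for each other one. The deeper cuts separate the points beyond a wall of this box, for which
-- another centre or corner is used.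
cover : Tree (ℕ × ℕ) 5
cover =
 cut y₁ c0 (cut y₂ c0 (cut y₃ c0 (cut y₄ c0 (cut y₅ c0 (cut y₃ -2m-1 (box 55455 44444)
       (box 55555 44444))
      (cut y₃ -2m-1 (cut y₅ c1 (box 55455 44444)
        (cut y₂ -2m-1 (box 55445 54444)
         (box 55455 54444)))
       (cut y₂ -2m-1 (cut y₅ c2 (box 55545 44444)
         (box 55545 54444))
        (box 55555 54444))))
     (cut y₅ c0 (cut y₁ -2m-1 (cut y₃ -2m-1 (box 55454 45444)
        (cut y₄ c2 (box 55554 44444)
         (box 55554 45444)))
       (box 55555 45444))
      (cut y₂ -2m-1 (cut y₅ c1 (cut y₁ -2m-1 (cut y₃ -2m-1 (box 55444 45444)
          (cut y₄ c2 (box 55544 44444)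
           (box 55544 45444)))
         (box 55545 45444))
        (box 55545 55444))
       (box 55555 55444))))
    (cut y₄ c0 (cut y₅ c0 (cut y₃ c1 (box 55555 44444)
       (cut y₁ -2m-1 (cut y₃ c2 (box 55554 44444)
         (cut y₄ -2m-1 (box 54554 44544)
          (box 55554 44544)))
        (cut y₄ -2m-1 (box 54555 44544)
         (box 55555 44544))))
      (cut y₄ -2m-1 (cut y₃ c2 (cut y₂ -2m-1 (cut y₅ c1 (box 54555 44444)
          (box 54545 54544))
         (box 54555 54444))
        (box 54555 54544))
       (box 55555 54544)))
     (cut y₅ c0 (cut y₃ c1 (cut y₁ -2m-1 (cut y₄ c2 (box 55554 44444)
         (box 55554 45444))
        (box 55555 45444))
       (cut y₁ -2m-1 (cut y₄ c2 (box 55554 44544)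
         (cut y₃ 2m+2 (box 55554 45544)
          (cut y₂ c-1 (box 55654 45544)
           (box 55554 45554))))
        (cut y₄ c1 (box 55555 44544)
         (cut y₃ 2m+2 (cut y₁ -2m (box 55554 45544)
           (box 55555 45544))
          (cut y₄ c2 (box 55655 44544)
           (cut y₂ c-1 (cut y₁ -2m+1 (box 55654 45544)
             (box 55655 45544))
            (box 55655 45554)))))))
      (cut y₄ c1 (box 55555 54544)
       (cut y₃ 2m+2 (cut y₁ -2m-1 (cut y₂ -2m-1 (box 55544 55544)
          (cut y₃ c1 (box 55554 55444)
           (box 55554 55544)))
         (box 55555 55544))
        (cut y₄ c2 (box 55655 54544)
         (cut y₁ -2m-1 (cut y₂ c-1 (box 55654 55544)
           (cut y₅ 2m+1 (box 55554 55554)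
            (box 65654 55554)))
          (box 55655 55544))))))))
   (cut y₃ c0 (cut y₄ c0 (cut y₅ c0 (cut y₂ 2m+2 (cut y₃ -2m-1 (cut y₂ c1 (box 55455 44444)
         (box 55455 44454))
        (cut y₂ c1 (box 55555 44444)
         (cut y₃ -2m (box 55455 44454)
          (box 55555 44454))))
       (cut y₁ c-1 (cut y₃ -2m (box 55465 44454)
         (box 55565 44454))
        (cut y₃ -2m-1 (box 55455 44455)
         (box 55565 44455))))
      (cut y₃ -2m-1 (cut y₂ c2 (box 55455 54444)
        (cut y₁ c-1 (cut y₅ 2m+2 (box 55455 54454)
          (box 65455 54454))
         (box 55455 54455)))
       (cut y₂ c1 (box 55555 54444)
        (cut y₅ 2m+2 (cut y₃ -2m (box 55455 54454)
          (box 55555 54454))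
         (cut y₂ c2 (box 65555 54444)
          (cut y₁ c-1 (cut y₃ -2m (box 65455 54454)
            (box 65555 54454))
           (box 65555 54455)))))))
     (cut y₅ c0 (cut y₂ 2m+2 (cut y₃ -2m-1 (cut y₂ c1 (cut y₁ -2m-1 (box 55454 45444)
          (box 55455 45444))
         (box 55455 45454))
        (box 55555 45454))
       (cut y₃ -2m-1 (cut y₁ c-1 (box 55465 45454)
         (cut y₄ 2m+2 (box 55455 45455)
          (box 56465 45455)))
        (box 55565 45454)))
      (cut y₂ c1 (box 55555 55444)
       (cut y₃ -2m-1 (cut y₅ 2m+2 (box 55455 55454)
         (cut y₂ c2 (box 55455 55444)
          (cut y₁ c-1 (box 65455 55454)
           (cut y₄ 2m+2 (box 55455 55455)
            (box 66455 55455)))))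
        (cut y₅ 2m+1 (box 55555 55454)
         (box 65555 55454))))))
    (cut y₄ c0 (cut y₅ c0 (cut y₂ 2m+1 (cut y₃ c1 (box 55555 44454)
        (cut y₄ -2m-1 (box 54555 44554)
         (box 55555 44554)))
       (cut y₃ c2 (box 55565 44454)
        (cut y₁ c-1 (cut y₄ -2m-1 (box 54565 44554)
          (box 55565 44554))
         (box 55565 44555))))
      (cut y₃ c1 (cut y₂ c1 (box 55555 54444)
        (cut y₅ 2m+1 (box 55555 54454)
         (box 65555 54454)))
       (cut y₄ -2m-1 (cut y₂ c1 (box 54555 54544)
         (cut y₁ c-1 (cut y₅ 2m+2 (cut y₂ 2m+2 (box 54555 54554)
            (cut y₃ c2 (box 54555 54454)
             (box 54565 54554)))
           (cut y₃ c2 (box 64555 54454)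
            (cut y₂ 2m+2 (box 64555 54554)
             (cut y₁ c-3 (box 64565 54554)
              (box 64565 54555)))))
          (box 54555 54555)))
        (cut y₂ c1 (box 55555 54544)
         (cut y₅ 2m+2 (cut y₂ 2m+2 (box 55555 54554)
           (box 55565 54554))
          (cut y₂ 2m+2 (box 65555 54554)
           (cut y₁ c-1 (box 65565 54554)
            (box 65555 54555))))))))
     (cut y₅ c0 (cut y₂ 2m+1 (cut y₄ c1 (box 55555 44554)
        (cut y₃ c1 (box 55555 45454)
         (cut y₁ -2m-1 (box 55554 45554)
          (box 55555 45554))))
       (cut y₃ c2 (box 55565 45454)
        (cut y₄ c1 (box 55565 44554)
         (cut y₅ c-1 (cut y₁ -2m-1 (box 55564 45554)
           (box 55565 45554))
          (box 55565 55554)))))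
      (cut y₂ 2m+2 (cut y₅ 2m+1 (box 55555 55554)
        (cut y₂ c1 (cut y₃ c1 (box 55555 55444)
          (cut y₄ c1 (box 55555 54544)
           (cut y₃ 2m+2 (cut y₁ -2m-1 (box 65554 55554)
             (box 55555 55544))
            (box 65655 55554))))
         (box 65555 55554)))
       (cut y₅ 2m+1 (cut y₃ c2 (box 55565 55454)
         (box 55565 55554))
        (cut y₃ c1 (box 65555 55454)
         (cut y₁ c-1 (box 65565 55554)
          (cut y₃ 2m+2 (box 55565 55555)
           (cut y₄ c1 (box 55565 54555)
            (box 65665 55554)))))))))))
  (cut y₂ c0 (cut y₃ c0 (cut y₄ c0 (cut y₅ c0 (cut y₂ -2m-1 (cut y₁ c2 (cut y₃ -2m-1 (cut y₅ -2m-1 (box 45445 44444)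
          (box 55445 44445))
         (box 55545 44444))
        (cut y₅ -2m-1 (box 45545 44445)
         (box 55545 44445)))
       (cut y₅ -2m-1 (cut y₁ c1 (cut y₃ -2m-1 (box 45455 44445)
          (box 45555 44444))
         (box 45555 44445))
        (box 55555 44445)))
      (cut y₁ c1 (cut y₂ -2m-1 (cut y₅ c2 (cut y₃ -2m-1 (box 55445 44445)
          (box 55545 44444))
         (cut y₃ -2m-1 (box 55445 54445)
          (box 55545 54444)))
        (cut y₃ -2m-1 (cut y₅ c1 (box 55455 44445)
          (cut y₂ -2m+1 (box 55445 54445)
           (box 55455 54445)))
         (box 55555 54444)))
       (cut y₂ -2m-1 (cut y₅ c2 (box 55545 44445)
         (cut y₃ c-1 (cut y₁ 2m+2 (box 55545 54445)
           (box 55546 54445))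
          (box 55545 54545)))
        (cut y₅ c1 (box 55555 44445)
         (cut y₁ 2m+2 (cut y₂ -2m+1 (box 55545 54445)
           (box 55555 54445))
          (cut y₅ c2 (box 55556 44445)
           (cut y₃ c-1 (cut y₂ -2m (box 55546 54445)
             (box 55556 54445))
            (box 55556 54545))))))))
     (cut y₅ c0 (cut y₁ c1 (box 55555 45444)
       (cut y₄ 2m+2 (cut y₅ -2m-1 (cut y₂ -2m-1 (cut y₁ c2 (box 45545 45444)
           (box 45545 45445))
          (box 45555 45445))
         (cut y₂ -2m-1 (box 55545 45445)
          (box 55555 45445)))
        (cut y₁ c2 (box 56555 45444)
         (cut y₅ -2m-1 (cut y₃ c-1 (cut y₂ -2m-1 (cut y₁ c3 (box 45545 45444)
             (box 46545 45445))
            (box 46555 45445))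
           (box 46555 45545))
          (cut y₃ c-1 (cut y₂ -2m-1 (box 56545 45445)
            (box 56555 45445))
           (box 56555 45545))))))
      (cut y₂ -2m-1 (cut y₅ c1 (cut y₁ c2 (box 55545 45444)
         (cut y₄ 2m+2 (box 55545 45445)
          (cut y₃ c-1 (box 56545 45445)
           (box 55545 45545))))
        (cut y₁ c2 (box 55545 55444)
         (cut y₄ 2m+1 (box 55545 55445)
          (cut y₃ c-1 (box 56545 55445)
           (box 55545 55545)))))
       (cut y₁ c1 (box 55555 55444)
        (cut y₄ 2m+2 (cut y₅ c1 (box 55555 45445)
          (cut y₂ -2m (box 55545 55445)
           (box 55555 55445)))
         (cut y₁ c2 (box 56555 55444)
          (cut y₃ c-1 (cut y₅ c1 (box 56555 45445)
            (cut y₂ -2m (box 56545 55445)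
             (box 56555 55445)))
           (box 56555 55545))))))))
    (cut y₄ c0 (cut y₅ c0 (cut y₅ -2m-1 (cut y₁ c1 (cut y₄ -2m-1 (cut y₃ c2 (box 44555 44444)
          (box 44555 44544))
         (box 45555 44544))
        (cut y₃ 2m+1 (box 45555 44545)
         (cut y₂ c-1 (cut y₁ c2 (cut y₄ -2m-1 (box 44655 44545)
            (box 45555 44544))
           (box 45655 44545))
          (box 45555 44555))))
       (cut y₃ 2m+1 (box 55555 44545)
        (cut y₄ -2m-1 (box 54655 44545)
         (cut y₁ c1 (box 55555 44544)
          (box 55655 44545)))))
      (cut y₃ 2m+2 (cut y₂ -2m-1 (cut y₅ c1 (box 55555 44545)
         (cut y₁ c1 (cut y₄ -2m-1 (box 54545 54545)
           (box 55545 54544))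
          (box 55545 54545)))
        (box 55555 54545))
       (cut y₁ c1 (cut y₄ -2m-1 (box 54655 54544)
         (box 55555 54544))
        (cut y₂ -2m-1 (cut y₅ c1 (box 55655 44545)
          (cut y₁ c2 (cut y₄ -2m-1 (box 54645 54545)
            (box 55545 54544))
           (box 55645 54545)))
         (box 55655 54545)))))
     (cut y₅ c0 (cut y₃ 2m+1 (cut y₅ -2m-1 (cut y₁ c2 (box 45555 45544)
         (box 45555 45545))
        (box 55555 45545))
       (cut y₄ c1 (cut y₁ c1 (box 55555 44544)
         (cut y₅ -2m-1 (cut y₂ c-1 (cut y₁ c2 (box 45555 44544)
            (box 45655 44545))
           (box 45555 44555))
          (box 55655 44545)))
        (cut y₁ c2 (box 55655 45544)
         (cut y₂ c-1 (cut y₅ -2m-1 (box 45655 45545)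
           (box 55655 45545))
          (box 55655 45555)))))
      (cut y₁ c1 (cut y₃ 2m+2 (box 55555 55544)
        (cut y₄ c1 (box 55555 54544)
         (box 55655 55544)))
       (cut y₂ -2m-1 (cut y₅ c1 (cut y₃ 2m+1 (box 55545 45545)
          (cut y₄ c1 (box 55655 44545)
           (box 55655 45545)))
         (cut y₃ 2m+1 (box 55545 55545)
          (cut y₄ c1 (cut y₁ c2 (box 55545 54544)
            (box 55645 54545))
           (cut y₁ c2 (box 55645 55544)
            (box 55645 55545)))))
        (cut y₃ 2m+1 (box 55555 55545)
         (cut y₄ c2 (box 55655 54545)
          (box 55655 55545))))))))
   (cut y₃ c0 (cut y₄ c0 (cut y₅ c0 (cut y₃ -2m-1 (cut y₂ c1 (cut y₅ -2m-1 (box 45455 44445)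
         (box 55455 44445))
        (cut y₁ 2m+2 (box 55455 44455)
         (cut y₄ c-1 (cut y₂ c2 (cut y₅ -2m-1 (box 45456 44445)
            (box 55455 44445))
           (box 55456 44455))
          (box 55455 45455))))
       (cut y₁ 2m+2 (box 55555 44455)
        (cut y₅ -2m-1 (box 45556 44455)
         (cut y₂ c2 (box 55556 44445)
          (box 55556 44455)))))
      (cut y₁ 2m+1 (cut y₃ -2m-1 (cut y₂ c2 (box 55455 54445)
         (box 55455 54455))
        (box 55555 54455))
       (cut y₅ c1 (cut y₂ c1 (box 55555 44445)
         (cut y₃ -2m-1 (cut y₂ c2 (box 55455 44445)
           (cut y₄ c-1 (box 55456 44455)
            (box 55455 45455)))
          (box 55556 44455)))
        (cut y₂ c2 (box 55556 54445)
         (cut y₄ c-1 (cut y₃ -2m-1 (box 55456 54455)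
           (box 55556 54455))
          (box 55556 55455))))))
     (cut y₅ c0 (cut y₄ 2m+2 (box 55555 45455)
       (cut y₂ 2m+2 (cut y₁ c1 (cut y₃ -2m-1 (cut y₂ c1 (box 56455 45444)
           (box 56455 45455))
          (box 55555 45454))
         (box 56555 45455))
        (box 56565 45455)))
      (cut y₂ c1 (cut y₁ c1 (box 55555 55444)
        (cut y₄ 2m+2 (box 55555 55445)
         (box 56555 55445)))
       (cut y₄ 2m+1 (cut y₁ 2m+2 (box 55555 55455)
         (cut y₅ c1 (box 55555 45455)
          (box 55556 55455)))
        (cut y₁ c1 (cut y₃ -2m-1 (box 56455 55455)
          (cut y₅ 2m+2 (box 55555 55454)
           (box 66555 55455)))
         (cut y₅ c1 (box 56555 45455)
          (cut y₁ 2m+2 (box 56555 55455)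
           (cut y₃ c-1 (box 56556 55455)
            (box 55556 55555)))))))))
    (cut y₄ c0 (cut y₅ c0 (cut y₂ 2m+2 (box 55555 44555)
       (cut y₃ c1 (cut y₁ 2m+2 (box 55555 44455)
         (box 55566 44455))
        (box 55565 44555)))
      (cut y₁ 2m+1 (box 55555 54555)
       (cut y₂ 2m+2 (cut y₅ c1 (box 55555 44555)
         (cut y₃ 2m+2 (cut y₂ c1 (box 55555 54545)
           (box 55556 54555))
          (box 55656 54555)))
        (box 55566 54555))))
     (cut y₅ c0 (cut y₄ c1 (cut y₂ 2m+1 (box 55555 44555)
        (cut y₃ c1 (box 55555 45455)
         (box 55565 44555)))
       (cut y₃ 2m+2 (cut y₂ 2m+2 (box 55555 45555)
         (cut y₃ c1 (cut y₄ 2m+2 (box 55555 45455)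
           (box 56565 45555))
          (box 55565 45555)))
        (cut y₂ 2m+1 (cut y₁ c2 (box 55655 45554)
          (box 55655 45555))
         (box 55665 45555))))
      (cut y₃ 2m+2 (box 55555 55555)
       (cut y₄ c1 (cut y₁ 2m+1 (box 55555 54555)
         (cut y₂ 2m+2 (cut y₅ c1 (box 55555 44555)
           (box 55656 54555))
          (box 55666 54555)))
        (cut y₂ 2m+2 (cut y₁ c1 (cut y₅ 2m+1 (box 55555 55554)
           (box 65655 55554))
          (box 55655 55555))
         (box 55665 55555))))))))

-- The descent stops in `region`, which exceeds `cube` by 1 on both sides in the coordinates 1, 4
-- and 5. Each leaf names a lattice vector whose subtraction brings its part into `cube`.
recentre : Tree ℕ 5
recentre =
 cut y₄ -2m-2 (cut y₅ -2m-1 (cut y₁ 2m+2 (cut y₃ -2m-1 (leaf 44455)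
     (cut y₃ -2m (leaf 44455)
      (cut y₅ -2m-2 (cut y₂ 2m+2 (cut y₁ -2m-2 (leaf 54554)
         (leaf 44555))
        (leaf 44565))
       (leaf 54555))))
    (leaf 44556))
   (cut y₁ 2m+3 (cut y₂ -2m (cut y₁ 2m+2 (cut y₁ -2m-2 (cut y₅ 2m+3 (cut y₃ -2m-1 (leaf 54444)
         (leaf 54555))
        (leaf 64545))
       (leaf 54545))
      (leaf 54545))
     (cut y₁ 2m+1 (cut y₃ -2m+1 (cut y₅ 2m+2 (leaf 54455)
        (cut y₃ -2m-1 (leaf 65455)
         (leaf 64555)))
       (cut y₅ 2m+3 (leaf 54555)
        (leaf 64555)))
      (leaf 54556)))
    (cut y₂ 2m+2 (cut y₅ -2m (leaf 44556)
      (cut y₂ -2m (cut y₃ 2m (leaf 54546)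
        (leaf 54646))
       (leaf 54556)))
     (leaf 54556))))
  (cut y₁ -2m-1 (cut y₅ 2m+1 (cut y₂ 2m+2 (cut y₄ 2m+3 (cut y₃ -2m+1 (cut y₅ -2m-2 (leaf 45454)
        (cut y₁ -2m-2 (leaf 55454)
         (leaf 55555)))
       (cut y₂ 2m+1 (cut y₄ -2m (cut y₅ -2m-2 (leaf 44554)
          (cut y₄ -2m-1 (leaf 54555)
           (leaf 55554)))
         (leaf 55554))
        (leaf 55565)))
      (leaf 56554))
     (cut y₄ 2m+1 (cut y₃ -2m (leaf 55465)
       (leaf 55565))
      (cut y₃ -2m-1 (leaf 56465)
       (cut y₄ 2m+3 (leaf 55565)
        (leaf 56564)))))
    (cut y₄ 2m+3 (cut y₅ 2m+3 (cut y₁ -2m-2 (cut y₃ -2m-1 (cut y₂ -2m-1 (leaf 55444)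
         (cut y₅ 2m+2 (leaf 55454)
          (leaf 65555)))
        (cut y₄ -2m-1 (leaf 54555)
         (leaf 65554)))
       (leaf 55555))
      (cut y₂ -2m-1 (cut y₄ -2m-1 (leaf 64545)
        (leaf 65544))
       (leaf 65555)))
     (leaf 66554)))
   (cut y₄ 2m+1 (cut y₂ -2m (cut y₅ -2m-1 (leaf 45555)
      (cut y₃ 2m+2 (leaf 55545)
       (cut y₁ 2m+3 (cut y₅ 2m+2 (leaf 55555)
         (cut y₄ -2m-1 (leaf 54545)
          (leaf 65655)))
        (leaf 55656))))
     (cut y₁ 2m+2 (cut y₅ 2m+3 (cut y₅ -2m-2 (cut y₃ -2m (leaf 45455)
         (cut y₂ 2m+2 (leaf 45555)
          (leaf 45565)))
        (leaf 55555))
       (leaf 65555))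
      (cut y₅ -2m-1 (cut y₂ 2m+1 (leaf 45555)
        (leaf 45566))
       (cut y₃ 2m+2 (leaf 55556)
        (cut y₅ 2m+3 (cut y₁ 2m+3 (leaf 55555)
          (leaf 55656))
         (leaf 65656))))))
    (cut y₅ -2m-1 (cut y₃ -2m-1 (leaf 46455)
      (cut y₂ 2m (cut y₄ 2m+3 (leaf 45555)
        (cut y₁ -2m (leaf 56554)
         (cut y₃ 2m+2 (leaf 46555)
          (leaf 45655))))
       (cut y₄ 2m+3 (cut y₂ 2m+1 (leaf 45555)
         (cut y₂ 2m+2 (leaf 45555)
          (cut y₁ 2m+1 (leaf 55565)
           (cut y₁ 2m+2 (leaf 55565)
            (cut y₄ 2m+2 (leaf 45566)
             (cut y₅ -2m-2 (leaf 46565)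
              (cut y₃ 2m+2 (leaf 56555)
               (leaf 55666))))))))
        (cut y₃ 2m+1 (cut y₅ -2m-2 (leaf 46565)
          (leaf 56555))
         (leaf 56665)))))
     (cut y₅ 2m+3 (cut y₄ 2m+3 (cut y₁ 2m+1 (leaf 55555)
        (cut y₁ 2m+2 (leaf 55555)
         (cut y₁ 2m+3 (leaf 55555)
          (cut y₃ 2m (cut y₂ -2m (leaf 55545)
            (leaf 56556))
           (leaf 55656)))))
       (cut y₃ 2m (leaf 56555)
        (cut y₅ 2m+2 (cut y₃ 2m+2 (leaf 56555)
          (cut y₂ 2m+1 (leaf 55655)
           (leaf 56665)))
         (leaf 66655))))
      (cut y₄ 2m+3 (cut y₃ 2m (cut y₂ -2m (leaf 55545)
         (cut y₁ 2m+2 (leaf 65555)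
          (leaf 66556)))
        (cut y₂ -2m-1 (leaf 65645)
         (cut y₁ 2m+2 (leaf 65555)
          (leaf 65656))))
       (cut y₃ 2m+1 (cut y₂ -2m-1 (leaf 66545)
         (cut y₁ 2m+3 (leaf 66555)
          (leaf 56556)))
        (leaf 66655)))))))

2k+1 : Poly
2k+1 = + 9 ∷ + 10 ∷ []

symmetric : List ℕ → Poly × Poly
symmetric b = -1ℤ ⊙ pos b , pos b

-- As small as `dominantᵇ` permits. For the first row it asks 12m + 23 ≤ 6t, which t = 2m + 4
-- satisfies and t = 2m + 3 does not; the bound is t - 1.
bounds : Vec (List ℕ) 5
bounds = (3 ∷ 2 ∷ []) ∷ (2 ∷ 2 ∷ []) ∷ (2 ∷ 2 ∷ []) ∷ (3 ∷ 2 ∷ []) ∷ (3 ∷ 2 ∷ []) ∷ []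

cube region : Box 5
cube   = replicate 5 (symmetric (2 ∷ 2 ∷ []))
region = map symmetric bounds

coverᵇ : Box 5 → ℕ × ℕ → Bool
coverᵇ Q (c , d) = withinᵇ Q (centre c) (corner d) 2k+1

recentreᵇ : Box 5 → ℕ → Bool
recentreᵇ Q c = translateᵇ Q (centre c) cube

-- The type checker evaluates the whole certificate. Since m does not occur, one evaluation is a
-- proof for every m.
cover-valid : T (check coverᵇ cover cube)
cover-valid = tt

recentre-valid : T (check recentreᵇ recentre region)
recentre-valid = tt

-- Reduction to a bounded region

⟦pos⟧ : ∀ p m → ⟦ pos p ⟧ m ≡ + evalℕ p m
⟦pos⟧ []      m = refl
⟦pos⟧ (c ∷ p) m = trans (cong (λ t → + c + + m * t) (⟦pos⟧ p m))
  (trans (cong (_+_ (+ c)) (sym (pos-* m (evalℕ p m)))) (cong +_ (ℕ.+-comm c (m ℕ.* evalℕ p m))))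

weighted : Vec ℕ n → Vec ℤ n → ℕ
weighted []       []       = 0
weighted (u ∷ us) (y ∷ ys) = u ℕ.* ∣ y ∣ ℕ.+ weighted us ys

weighted-neg : ∀ (us : Vec ℕ n) ys → weighted us (map -_ ys) ≡ weighted us ys
weighted-neg []       []       = refl
weighted-neg (u ∷ us) (y ∷ ys) = cong₂ (λ s t → u ℕ.* s ℕ.+ t) (∣-i∣≡∣i∣ y) (weighted-neg us ys)

weighted-- : ∀ (us : Vec ℕ n) ys vs → weighted us (ys -ᵛ vs) ℕ.≤ weighted us ys ℕ.+ weighted us vs
weighted-- []       []       []       = z≤n
weighted-- (u ∷ us) (y ∷ ys) (v ∷ vs) = begin
  u ℕ.* ∣ y - v ∣ ℕ.+ weighted us (ys -ᵛ vs)
    ≤⟨ ℕ.+-mono-≤ (ℕ.*-monoʳ-≤ u (∣i-j∣≤∣i∣+∣j∣ y v)) (weighted-- us ys vs) ⟩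
  u ℕ.* (∣ y ∣ ℕ.+ ∣ v ∣) ℕ.+ (weighted us ys ℕ.+ weighted us vs)
    ≡⟨ lem u ∣ y ∣ ∣ v ∣ (weighted us ys) (weighted us vs) ⟩
  (u ℕ.* ∣ y ∣ ℕ.+ weighted us ys) ℕ.+ (u ℕ.* ∣ v ∣ ℕ.+ weighted us vs) ∎
  where
  open ℕ.≤-Reasoning
  lem : ∀ u y v s t → u ℕ.* (y ℕ.+ v) ℕ.+ (s ℕ.+ t) ≡ (u ℕ.* y ℕ.+ s) ℕ.+ (u ℕ.* v ℕ.+ t)
  lem = ℕ.solve-∀

-- The triangle inequality in all coordinates but the i-th, where the exact value is kept. The
-- additive form avoids truncated subtraction.
weighted-split : ∀ (us : Vec ℕ n) ys vs i →
  weighted us (ys -ᵛ vs) ℕ.+ lookup us i ℕ.* (∣ lookup ys i ∣ ℕ.+ ∣ lookup vs i ∣)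
  ℕ.≤ (weighted us ys ℕ.+ weighted us vs) ℕ.+ lookup us i ℕ.* ∣ lookup ys i - lookup vs i ∣
weighted-split (u ∷ us) (y ∷ ys) (v ∷ vs) zero = begin
  (u ℕ.* ∣ y - v ∣ ℕ.+ weighted us (ys -ᵛ vs)) ℕ.+ u ℕ.* (∣ y ∣ ℕ.+ ∣ v ∣)
    ≤⟨ ℕ.+-monoˡ-≤ _ (ℕ.+-monoʳ-≤ (u ℕ.* ∣ y - v ∣) (weighted-- us ys vs)) ⟩
  (u ℕ.* ∣ y - v ∣ ℕ.+ (weighted us ys ℕ.+ weighted us vs)) ℕ.+ u ℕ.* (∣ y ∣ ℕ.+ ∣ v ∣)
    ≡⟨ lem u (∣ y - v ∣) ∣ y ∣ ∣ v ∣ (weighted us ys) (weighted us vs) ⟩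
  ((u ℕ.* ∣ y ∣ ℕ.+ weighted us ys) ℕ.+ (u ℕ.* ∣ v ∣ ℕ.+ weighted us vs)) ℕ.+ u ℕ.* ∣ y - v ∣ ∎
  where
  open ℕ.≤-Reasoning
  lem : ∀ u d y v s t → (u ℕ.* d ℕ.+ (s ℕ.+ t)) ℕ.+ u ℕ.* (y ℕ.+ v) ≡ ((u ℕ.* y ℕ.+ s) ℕ.+ (u ℕ.* v ℕ.+ t)) ℕ.+ u ℕ.* d
  lem = ℕ.solve-∀
weighted-split (u ∷ us) (y ∷ ys) (v ∷ vs) (suc i) = begin
  (u ℕ.* ∣ y - v ∣ ℕ.+ weighted us (ys -ᵛ vs)) ℕ.+ a
    ≡⟨ ℕ.+-assoc (u ℕ.* ∣ y - v ∣) (weighted us (ys -ᵛ vs)) a ⟩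
  u ℕ.* ∣ y - v ∣ ℕ.+ (weighted us (ys -ᵛ vs) ℕ.+ a)
    ≤⟨ ℕ.+-mono-≤ (ℕ.*-monoʳ-≤ u (∣i-j∣≤∣i∣+∣j∣ y v)) (weighted-split us ys vs i) ⟩
  u ℕ.* (∣ y ∣ ℕ.+ ∣ v ∣) ℕ.+ ((weighted us ys ℕ.+ weighted us vs) ℕ.+ b)
    ≡⟨ lem u ∣ y ∣ ∣ v ∣ (weighted us ys) (weighted us vs) b ⟩
  ((u ℕ.* ∣ y ∣ ℕ.+ weighted us ys) ℕ.+ (u ℕ.* ∣ v ∣ ℕ.+ weighted us vs)) ℕ.+ b ∎
  where
  open ℕ.≤-Reasoning
  a = lookup us i ℕ.* (∣ lookup ys i ∣ ℕ.+ ∣ lookup vs i ∣)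
  b = lookup us i ℕ.* ∣ lookup ys i - lookup vs i ∣
  lem : ∀ u y v s t b → u ℕ.* (y ℕ.+ v) ℕ.+ ((s ℕ.+ t) ℕ.+ b) ≡ ((u ℕ.* y ℕ.+ s) ℕ.+ (u ℕ.* v ℕ.+ t)) ℕ.+ b
  lem = ℕ.solve-∀

-- Compared with the sum, the difference loses twice the smaller number a, and a ≥ t.
∣⊖∣-gap : ∀ {t a b} → a ℕ.≤ b → t ℕ.≤ a → ∣ a ℤ.⊖ b ∣ ℕ.+ 2 ℕ.* t ℕ.≤ a ℕ.+ b
∣⊖∣-gap {t} {a} {b} a≤b t≤a = begin
  ∣ a ℤ.⊖ b ∣ ℕ.+ 2 ℕ.* t ≡⟨ cong (ℕ._+ 2 ℕ.* t) (∣⊖∣-≤ a≤b) ⟩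
  b ℕ.∸ a ℕ.+ 2 ℕ.* t     ≤⟨ ℕ.+-monoʳ-≤ (b ℕ.∸ a) (ℕ.*-monoʳ-≤ 2 t≤a) ⟩
  b ℕ.∸ a ℕ.+ 2 ℕ.* a     ≡⟨ lem (b ℕ.∸ a) a ⟩
  a ℕ.+ (b ℕ.∸ a ℕ.+ a)   ≡⟨ cong (a ℕ.+_) (ℕ.m∸n+n≡m a≤b) ⟩
  a ℕ.+ b                 ∎
  where
  open ℕ.≤-Reasoning
  lem : ∀ d a → d ℕ.+ 2 ℕ.* a ≡ a ℕ.+ (d ℕ.+ a)
  lem = ℕ.solve-∀

∣-∣-gap : ∀ {t y v} → + t ≤ y → + t ≤ v → ∣ y - v ∣ ℕ.+ 2 ℕ.* t ℕ.≤ ∣ y ∣ ℕ.+ ∣ v ∣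
∣-∣-gap {t} {+ a} {+ b} (+≤+ t≤a) (+≤+ t≤b) rewrite m-n≡m⊖n a b with ℕ.≤-total a b
... | inj₁ a≤b = ∣⊖∣-gap a≤b t≤a
... | inj₂ b≤a rewrite ∣m⊖n∣≡∣n⊖m∣ a b | ℕ.+-comm a b = ∣⊖∣-gap b≤a t≤b

-- Subtracting v decreases the i-th term of the weighted norm by more than
-- it can increase the others.
weighted-descent : ∀ (us : Vec ℕ n) ys vs i t → + t ≤ lookup ys i → + t ≤ lookup vs i →
  weighted us vs ℕ.< 2 ℕ.* (lookup us i ℕ.* t) → weighted us (ys -ᵛ vs) ℕ.< weighted us ys
weighted-descent us ys vs i t t≤y t≤v small =
  ℕ.+-cancelʳ-< (2 ℕ.* (u ℕ.* t)) W′ W (ℕ.≤-<-trans (ℕ.+-cancelʳ-≤ (u ℕ.* d) _ _ main) (ℕ.+-monoʳ-< W small))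
  where
  u = lookup us i
  d = ∣ lookup ys i - lookup vs i ∣
  W = weighted us ys
  W′ = weighted us (ys -ᵛ vs)
  lem : ∀ w u t d → (w ℕ.+ 2 ℕ.* (u ℕ.* t)) ℕ.+ u ℕ.* d ≡ w ℕ.+ u ℕ.* (d ℕ.+ 2 ℕ.* t)
  lem = ℕ.solve-∀
  open ℕ.≤-Reasoning
  main : (W′ ℕ.+ 2 ℕ.* (u ℕ.* t)) ℕ.+ u ℕ.* d ℕ.≤ (W ℕ.+ weighted us vs) ℕ.+ u ℕ.* d
  main = begin
    (W′ ℕ.+ 2 ℕ.* (u ℕ.* t)) ℕ.+ u ℕ.* d                  ≡⟨ lem W′ u t d ⟩
    W′ ℕ.+ u ℕ.* (d ℕ.+ 2 ℕ.* t)                          ≤⟨ ℕ.+-monoʳ-≤ W′ (ℕ.*-monoʳ-≤ u (∣-∣-gap t≤y t≤v)) ⟩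
    W′ ℕ.+ u ℕ.* (∣ lookup ys i ∣ ℕ.+ ∣ lookup vs i ∣)     ≤⟨ weighted-split us ys vs i ⟩
    (W ℕ.+ weighted us vs) ℕ.+ u ℕ.* d                    ∎

absᴾ : Poly → List ℕ
absᴾ p = List.map ∣_∣ p

∣⟦⟧∣≤ : ∀ p m → ∣ ⟦ p ⟧ m ∣ ℕ.≤ evalℕ (absᴾ p) m
∣⟦⟧∣≤ []      m = z≤n
∣⟦⟧∣≤ (c ∷ p) m = begin
  ∣ c + + m * ⟦ p ⟧ m ∣             ≤⟨ ∣i+j∣≤∣i∣+∣j∣ c (+ m * ⟦ p ⟧ m) ⟩
  ∣ c ∣ ℕ.+ ∣ + m * ⟦ p ⟧ m ∣       ≡⟨ cong (∣ c ∣ ℕ.+_) (∣i*j∣≡∣i∣*∣j∣ (+ m) (⟦ p ⟧ m)) ⟩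
  ∣ c ∣ ℕ.+ m ℕ.* ∣ ⟦ p ⟧ m ∣       ≤⟨ ℕ.+-monoʳ-≤ ∣ c ∣ (ℕ.*-monoʳ-≤ m (∣⟦⟧∣≤ p m)) ⟩
  ∣ c ∣ ℕ.+ m ℕ.* evalℕ (absᴾ p) m  ≡⟨ ℕ.+-comm ∣ c ∣ (m ℕ.* evalℕ (absᴾ p) m) ⟩
  m ℕ.* evalℕ (absᴾ p) m ℕ.+ ∣ c ∣  ∎
  where open ℕ.≤-Reasoning

-- Absolute values are taken coefficientwise, so that the result is again a polynomial and `_≼_` can
-- decide about it. Nothing is lost on the rows of `V`, where the coefficients of each entry do not
-- differ in sign.
weightedᴾ : Vec ℕ n → Vec Poly n → Poly
weightedᴾ []       []       = []
weightedᴾ (u ∷ us) (p ∷ ps) = + u ⊙ pos (absᴾ p) ⊕ weightedᴾ us ps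

weighted≤ : ∀ (us : Vec ℕ n) ps m → + weighted us (⟦ ps ⟧ᵛ m) ≤ ⟦ weightedᴾ us ps ⟧ m
weighted≤ []       []       m = ≤-refl
weighted≤ (u ∷ us) (p ∷ ps) m = begin
  + (u ℕ.* ∣ ⟦ p ⟧ m ∣) + + weighted us (⟦ ps ⟧ᵛ m)
    ≤⟨ +-mono-≤ (+≤+ (ℕ.*-monoʳ-≤ u (∣⟦⟧∣≤ p m))) (weighted≤ us ps m) ⟩
  + (u ℕ.* evalℕ (absᴾ p) m) + ⟦ weightedᴾ us ps ⟧ m
    ≡⟨ cong (_+ ⟦ weightedᴾ us ps ⟧ m) (trans (pos-* u (evalℕ (absᴾ p) m))
         (trans (cong (_*_ (+ u)) (sym (⟦pos⟧ (absᴾ p) m))) (sym (⟦⊙⟧ (+ u) (pos (absᴾ p)) m)))) ⟩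
  ⟦ + u ⊙ pos (absᴾ p) ⟧ m + ⟦ weightedᴾ us ps ⟧ m
    ≡⟨ sym (⟦⊕⟧ (+ u ⊙ pos (absᴾ p)) (weightedᴾ us ps) m) ⟩
  ⟦ weightedᴾ (u ∷ us) (p ∷ ps) ⟧ m ∎
  where open ≤-Reasoning

inside-symmetric : ∀ {m} (ys : Vec ℤ n) (bs : Vec (List ℕ) n) →
                   (∀ i → ∣ lookup ys i ∣ ℕ.≤ evalℕ (lookup bs i) m) → Inside m ys (map symmetric bs)
inside-symmetric []       []       ∣y∣≤b = []
inside-symmetric {m = m} (y ∷ ys) (b ∷ bs) ∣y∣≤b =
  (subst (_≤ y) (sym low) (∣∣≤⇒-≤ y (∣y∣≤b zero)) , subst (y ≤_) (sym (⟦pos⟧ b m)) (∣∣≤⇒≤ y (∣y∣≤b zero)))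
  ∷ inside-symmetric ys bs (λ i → ∣y∣≤b (suc i))
  where
  low : ⟦ -1ℤ ⊙ pos b ⟧ m ≡ - + evalℕ b m
  low = trans (⟦⊙⟧ (-1ℤ) (pos b) m) (trans (-1*i≡-i (⟦ pos b ⟧ m)) (cong -_ (⟦pos⟧ b m)))
  ∣∣≤⇒≤ : ∀ y {b} → ∣ y ∣ ℕ.≤ b → y ≤ + b
  ∣∣≤⇒≤ (+ y)    y≤b = +≤+ y≤b
  ∣∣≤⇒≤ -[1+ y ] y≤b = -≤+
  ∣∣≤⇒-≤ : ∀ y {b} → ∣ y ∣ ℕ.≤ b → - + b ≤ y
  ∣∣≤⇒-≤ y {b} y≤b = subst (- + b ≤_) (neg-involutive y)
    (neg-mono-≤ (∣∣≤⇒≤ (- y) (subst (ℕ._≤ b) (sym (∣-i∣≡∣i∣ y)) y≤b)))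

-- With these weights V is strictly diagonally dominant for all m; with equal
-- weights this fails at m = 0.
weights : Vec ℕ 5
weights = 3 ∷ 3 ∷ 3 ∷ 2 ∷ 2 ∷ []

threshold : Fin 5 → Poly
threshold i = (1ℤ ∷ []) ⊕ pos (lookup bounds i)

-- What `weighted-descent` requires of a row: its diagonal entry reaches the threshold t, and its
-- weighted norm is strictly below 2uᵢt. The added 1 expresses strictness.
dominantᵇ : Fin 5 → Bool
dominantᵇ i = (threshold i ≼ lookup (lookup V i) i)
  ∧ ((1ℤ ∷ []) ⊕ weightedᴾ weights (lookup V i) ≼ (+ (2 ℕ.* lookup weights i)) ⊙ threshold i)

dominant : ∀ i → T (dominantᵇ i)
dominant y₁ = tt
dominant y₂ = tt
dominant y₃ = tt
dominant y₄ = tt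
dominant y₅ = tt

row : ℕ → Fin 5 → Vec ℤ 5
row m i = ⟦ lookup V i ⟧ᵛ m

module _ (m : ℕ) where

  private
    limit : Fin 5 → ℕ
    limit i = suc (evalℕ (lookup bounds i) m)

    ⟦threshold⟧ : ∀ i → ⟦ threshold i ⟧ m ≡ + limit i
    ⟦threshold⟧ i = trans (⟦⊕⟧ (1ℤ ∷ []) (pos (lookup bounds i)) m) (cong₂ _+_ (⟦const⟧ 1ℤ m) (⟦pos⟧ (lookup bounds i) m))

    limit≤ : ∀ i → + limit i ≤ lookup (row m i) i
    limit≤ i = subst₂ _≤_ (⟦threshold⟧ i) (sym (lookup-map i (λ p → ⟦ p ⟧ m) (lookup V i)))
      (≼-sound (threshold i) (lookup (lookup V i) i) (proj₁ (∧-elim {threshold i ≼ lookup (lookup V i) i} (dominant i))))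

    weighted< : ∀ i → weighted weights (row m i) ℕ.< 2 ℕ.* (lookup weights i ℕ.* limit i)
    weighted< i = drop‿+≤+ (begin
      + 1 + + weighted weights (row m i)                           ≤⟨ +-monoʳ-≤ 1ℤ (weighted≤ weights (lookup V i) m) ⟩
      1ℤ + ⟦ weightedᴾ weights (lookup V i) ⟧ m                    ≡⟨ cong (_+ ⟦ weightedᴾ weights (lookup V i) ⟧ m) (sym (⟦const⟧ 1ℤ m)) ⟩
      ⟦ 1ℤ ∷ [] ⟧ m + ⟦ weightedᴾ weights (lookup V i) ⟧ m          ≡⟨ sym (⟦⊕⟧ (1ℤ ∷ []) (weightedᴾ weights (lookup V i)) m) ⟩
      ⟦ (1ℤ ∷ []) ⊕ weightedᴾ weights (lookup V i) ⟧ m             ≤⟨ ≼-sound ((1ℤ ∷ []) ⊕ weightedᴾ weights (lookup V i)) (+ (2 ℕ.* lookup weights i) ⊙ threshold i)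
                                                                       (proj₂ (∧-elim {threshold i ≼ lookup (lookup V i) i} (dominant i))) ⟩
      ⟦ + (2 ℕ.* lookup weights i) ⊙ threshold i ⟧ m               ≡⟨ ⟦⊙⟧ (+ (2 ℕ.* lookup weights i)) (threshold i) m ⟩
      + (2 ℕ.* lookup weights i) * ⟦ threshold i ⟧ m               ≡⟨ cong (_*_ (+ (2 ℕ.* lookup weights i))) (⟦threshold⟧ i) ⟩
      + (2 ℕ.* lookup weights i) * + limit i                       ≡⟨ sym (pos-* (2 ℕ.* lookup weights i) (limit i)) ⟩
      + (2 ℕ.* lookup weights i ℕ.* limit i)                       ≡⟨ cong +_ (ℕ.*-assoc 2 (lookup weights i) (limit i)) ⟩
      + (2 ℕ.* (lookup weights i ℕ.* limit i))                     ∎)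
      where open ≤-Reasoning

    neg-sub : ∀ {n} (ys vs : Vec ℤ n) → map -_ (map -_ ys -ᵛ vs) ≡ ys +ᵛ vs
    neg-sub []       []       = refl
    neg-sub (y ∷ ys) (v ∷ vs) = cong₂ _∷_ (lem y v) (neg-sub ys vs)
      where
      lem : ∀ y v → - (- y - v) ≡ y + v
      lem = solve-∀

    sub-descent : ∀ ys i → + limit i ≤ lookup ys i → weighted weights (ys -ᵛ row m i) ℕ.< weighted weights ys
    sub-descent ys i limit≤y = weighted-descent weights ys (row m i) i (limit i) limit≤y (limit≤ i) (weighted< i)

    add-descent : ∀ ys i → + limit i ≤ - lookup ys i → weighted weights (ys +ᵛ row m i) ℕ.< weighted weights ys
    add-descent ys i limit≤-y = subst₂ ℕ._<_
      (trans (sym (weighted-neg weights (map -_ ys -ᵛ row m i))) (cong (weighted weights) (neg-sub ys (row m i))))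
      (weighted-neg weights ys)
      (sub-descent (map -_ ys) i (subst (+ limit i ≤_) (sym (lookup-map i -_ ys)) limit≤-y))

    large : ∀ {t} y → t ℕ.≤ ∣ y ∣ → + t ≤ y ⊎ + t ≤ - y
    large (+ y)    t≤y = inj₁ (+≤+ t≤y)
    large -[1+ y ] t≤y = inj₂ (+≤+ t≤y)

  -- Well-founded induction on the weighted norm. Outside `region` some coordinate exceeds its
  -- bound, and the row with that index is subtracted or added according to the sign of the
  -- coordinate.
  reduction : (P : Vec ℤ 5 → Set) → (∀ y i → P (y -ᵛ row m i) → P y) → (∀ y i → P (y +ᵛ row m i) → P y) →
              (∀ y → Inside m y region → P y) → ∀ y → P y
  reduction P sub add base y = go y (<-wellFounded (weighted weights y))
    where
    go : ∀ y → Acc ℕ._<_ (weighted weights y) → P y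
    go y (acc rec) with all? (λ i → ∣ lookup y i ∣ ℕ.≤? evalℕ (lookup bounds i) m)
    ... | yes small = base y (inside-symmetric y bounds small)
    ... | no ¬small with ¬∀⟶∃¬ 5 _ (λ i → ∣ lookup y i ∣ ℕ.≤? evalℕ (lookup bounds i) m) ¬small
    ... | i , ≰ with large (lookup y i) (ℕ.≰⇒> ≰)
    ... | inj₁ limit≤y  = sub y i (go (y -ᵛ row m i) (rec (sub-descent y i limit≤y)))
    ... | inj₂ limit≤-y = add y i (go (y +ᵛ row m i) (rec (add-descent y i limit≤-y)))

-- The upper bound

-- The polynomials of the theorem at k = 5m + 4, here and in `generatorsᴾ`, with the denominators
-- divided out.
orderᴾ : List ℕ
orderᴾ = 457 ∷ 2186 ∷ 4288 ∷ 4352 ∷ 2304 ∷ 512 ∷ []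

generatorsᴾ : Vec (List ℕ) 5
generatorsᴾ =
  (1 ∷ []) ∷
  (35 ∷ 92 ∷ 88 ∷ 32 ∷ []) ∷
  (116 ∷ 434 ∷ 640 ∷ 448 ∷ 128 ∷ []) ∷
  (143 ∷ 512 ∷ 720 ∷ 480 ∷ 128 ∷ []) ∷
  (220 ∷ 850 ∷ 1272 ∷ 896 ∷ 256 ∷ []) ∷ []

-- The constant stands in front so that `order m` reduces to a successor; then
-- `suc (pred (order m))` is definitionally `order m`.
order : ℕ → ℕ
order m = 457 ℕ.+ m ℕ.* evalℕ (List.drop 1 orderᴾ) m

generators : ℕ → Vec ℕ 5
generators m = map (λ p → evalℕ p m) generatorsᴾ

⟦map-pos⟧ : ∀ (ps : Vec (List ℕ) n) m → ⟦ map pos ps ⟧ᵛ m ≡ map +_ (map (λ p → evalℕ p m) ps)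
⟦map-pos⟧ []       m = refl
⟦map-pos⟧ (p ∷ ps) m = cong₂ _∷_ (⟦pos⟧ p m) (⟦map-pos⟧ ps m)

order≡ : ∀ m → evalℕ orderᴾ m ≡ order m
order≡ m = ℕ.+-comm (m ℕ.* evalℕ (List.drop 1 orderᴾ) m) 457

⟦order⟧ : ∀ m → ⟦ pos orderᴾ ⟧ m ≡ + order m
⟦order⟧ m = trans (⟦pos⟧ orderᴾ m) (cong +_ (order≡ m))

module _ (m : ℕ) where

  private
    g = map +_ (generators m)

  -- The certificate `q` is the quotient by n. The quotients turn out to be constant: 2 for `w`, and
  -- 0, 0, 1, 1, 2 for the rows of `V`, whose sum 4 agrees with Σ V = 2w.
  ∣-dot : ∀ r q → T (dotᴾ r (map pos generatorsᴾ) ≅ q ⊗ pos orderᴾ) → + order m ∣ℤ.∣ dot (⟦ r ⟧ᵛ m) g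
  ∣-dot r q t = divides (⟦ q ⟧ m) (begin
    dot (⟦ r ⟧ᵛ m) g                            ≡⟨ cong (dot (⟦ r ⟧ᵛ m)) (sym (⟦map-pos⟧ generatorsᴾ m)) ⟩
    dot (⟦ r ⟧ᵛ m) (⟦ map pos generatorsᴾ ⟧ᵛ m) ≡⟨ sym (⟦dotᴾ⟧ r (map pos generatorsᴾ) m) ⟩
    ⟦ dotᴾ r (map pos generatorsᴾ) ⟧ m          ≡⟨ ≅-sound (dotᴾ r (map pos generatorsᴾ)) (q ⊗ pos orderᴾ) t ⟩
    ⟦ q ⊗ pos orderᴾ ⟧ m                        ≡⟨ ⟦⊗⟧ q (pos orderᴾ) m ⟩
    ⟦ q ⟧ m * ⟦ pos orderᴾ ⟧ m                  ≡⟨ cong (_*_ (⟦ q ⟧ m)) (⟦order⟧ m) ⟩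
    ⟦ q ⟧ m * + order m                         ∎)
    where open ≡-Reasoning

  w-∣ : + order m ∣ℤ.∣ dot (⟦ w ⟧ᵛ m) g
  w-∣ = ∣-dot w (+ 2 ∷ []) tt

  V-∣ : All (λ r → + order m ∣ℤ.∣ dot r g) (⟦ V ⟧ᴹ m)
  V-∣ = ∣-dot (lookup V y₁) [] tt ∷ ∣-dot (lookup V y₂) [] tt ∷ ∣-dot (lookup V y₃) (+ 1 ∷ []) tt ∷ ∣-dot (lookup V y₄) (+ 1 ∷ []) tt ∷ ∣-dot (lookup V y₅) (+ 2 ∷ []) tt ∷ []

  centre-∣ : ∀ c → + order m ∣ℤ.∣ dot (⟦ centre c ⟧ᵛ m) g
  centre-∣ c = subst (λ r → + order m ∣ℤ.∣ dot r g) (sym (⟦combᴾ⟧ (digits 5 c) V m)) (∣-dot-comb V-∣ (⟦ digits 5 c ⟧ᵛ m))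

  corner-∣ : ∀ c → + order m ∣ℤ.∣ dot (⟦ corner c ⟧ᵛ m) g
  corner-∣ c = subst (+ order m ∣ℤ.∣_)
    (sym (trans (cong (λ r → dot r g) (⟦⊕ᵛ⟧ w (centre c) m)) (dot-+ (⟦ w ⟧ᵛ m) (⟦ centre c ⟧ᵛ m) g)))
    (∣m∣n⇒∣m+n w-∣ (centre-∣ c))

  -- Depends only on the class of y modulo Λ, so y may be moved by lattice vectors until it lies in
  -- `cube`.
  Close : Vec ℤ 5 → Set
  Close y = ∃ λ y′ → ‖ y′ ‖ ℕ.≤ 5 ℕ.* m ℕ.+ 4 × + order m ∣ℤ.∣ dot y′ g - dot y g

  private
    sub-∣ : ∀ y a → + order m ∣ℤ.∣ dot a g → + order m ∣ℤ.∣ dot (y -ᵛ a) g - dot y g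
    sub-∣ y a n∣a = subst (+ order m ∣ℤ.∣_)
      (trans (lem (dot y g) (dot a g)) (cong (_- dot y g) (sym (dot-- y a g)))) (∣m⇒∣-m n∣a)
      where
      lem : ∀ y a → - a ≡ (y - a) - y
      lem = solve-∀

    add-∣ : ∀ y a → + order m ∣ℤ.∣ dot a g → + order m ∣ℤ.∣ dot (y +ᵛ a) g - dot y g
    add-∣ y a n∣a = subst (+ order m ∣ℤ.∣_)
      (trans (lem (dot y g) (dot a g)) (cong (_- dot y g) (sym (dot-+ y a g)))) n∣a
      where
      lem : ∀ y a → a ≡ (y + a) - y
      lem = solve-∀

    Close-resp : ∀ y z → + order m ∣ℤ.∣ dot z g - dot y g → Close z → Close y
    Close-resp y z n∣z-y (x , ‖x‖≤k , n∣x-z) = x , ‖x‖≤k ,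
      subst (+ order m ∣ℤ.∣_) (lem (dot x g) (dot z g) (dot y g)) (∣m∣n⇒∣m+n n∣x-z n∣z-y)
      where
      lem : ∀ x z y → (x - z) + (z - y) ≡ x - y
      lem = solve-∀

    ⟦2k+1⟧ : ⟦ 2k+1 ⟧ m ≡ + (suc (2 ℕ.* (5 ℕ.* m ℕ.+ 4)))
    ⟦2k+1⟧ = trans (⟦pos⟧ (9 ∷ 10 ∷ []) m) (cong +_ (lem m))
      where
      lem : ∀ m → m ℕ.* (m ℕ.* 0 ℕ.+ 10) ℕ.+ 9 ≡ suc (2 ℕ.* (5 ℕ.* m ℕ.+ 4))
      lem = ℕ.solve-∀

    half : ∀ {a b k} → a ℕ.+ b ℕ.≤ suc (2 ℕ.* k) → a ℕ.≤ k ⊎ b ℕ.≤ k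
    half {a} {b} {k} a+b≤2k+1 with a ℕ.≤? k | b ℕ.≤? k
    ... | yes a≤k | _       = inj₁ a≤k
    ... | no _    | yes b≤k = inj₂ b≤k
    ... | no a≰k  | no b≰k  = contradiction
      (ℕ.≤-trans (ℕ.+-mono-≤ (ℕ.≰⇒> a≰k) (ℕ.≰⇒> b≰k)) a+b≤2k+1) (ℕ.<⇒≱ (ℕ.≤-reflexive (lem k)))
      where
      lem : ∀ k → suc (suc (2 ℕ.* k)) ≡ suc k ℕ.+ suc k
      lem = ℕ.solve-∀

  within-Close : ∀ {y Q} as bs → T (withinᵇ Q as bs 2k+1) → Inside m y Q →
                 + order m ∣ℤ.∣ dot (⟦ as ⟧ᵛ m) g → + order m ∣ℤ.∣ dot (⟦ bs ⟧ᵛ m) g → Close y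
  within-Close {y} as bs t y∈Q n∣a n∣b =
    [ (λ ≤k → y -ᵛ ⟦ as ⟧ᵛ m , ≤k , sub-∣ y (⟦ as ⟧ᵛ m) n∣a)
    , (λ ≤k → y -ᵛ ⟦ bs ⟧ᵛ m , ≤k , sub-∣ y (⟦ bs ⟧ᵛ m) n∣b)
    ]′ (half (drop‿+≤+ (subst (+ ‖ y -ᵛ ⟦ as ⟧ᵛ m ‖ + + ‖ y -ᵛ ⟦ bs ⟧ᵛ m ‖ ≤_) ⟦2k+1⟧ (within-sound as bs 2k+1 t y∈Q))))

  cube-Close : ∀ y → Inside m y cube → Close y
  cube-Close y = check-sound {ok = coverᵇ} step cover cube cover-valid
    where
    step : ∀ Q c → T (coverᵇ Q c) → Inside m y Q → Close y
    step Q (c , d) t y∈Q = within-Close (centre c) (corner d) t y∈Q (centre-∣ c) (corner-∣ d)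

  region-Close : ∀ y → Inside m y region → Close y
  region-Close y = check-sound {ok = recentreᵇ} step recentre region recentre-valid
    where
    step : ∀ Q c → T (recentreᵇ Q c) → Inside m y Q → Close y
    step Q c t y∈Q = Close-resp y (y -ᵛ ⟦ centre c ⟧ᵛ m) (sub-∣ y (⟦ centre c ⟧ᵛ m) (centre-∣ c))
      (cube-Close (y -ᵛ ⟦ centre c ⟧ᵛ m) (translate-sound (centre c) cube t y∈Q))

  row-∣ : ∀ i → + order m ∣ℤ.∣ dot (row m i) g
  row-∣ i = subst (λ r → + order m ∣ℤ.∣ dot r g) (lookup-map i (λ r → ⟦ r ⟧ᵛ m) V) (All.lookup V-∣ (∈-lookup i (⟦ V ⟧ᴹ m)))

  all-Close : ∀ y → Close y
  all-Close = reduction m Close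
    (λ y i → Close-resp y (y -ᵛ row m i) (sub-∣ y (row m i) (row-∣ i)))
    (λ y i → Close-resp y (y +ᵛ row m i) (add-∣ y (row m i) (row-∣ i)))
    region-Close

  diameter-≤ : (i j : Fin (order m)) → ∃ λ l → l ℕ.≤ 5 ℕ.* m ℕ.+ 4 × Walk (order m) (toList (generators m)) l i j
  -- As g₁ = 1, the vector (d, 0, 0, 0, 0) represents the difference d = j - i.
  diameter-≤ i j = walk (all-Close (d ∷ 0ᵛ))
    where
    d = + toℕ j - + toℕ i
    start : ∀ d → dot (d ∷ 0ᵛ) g ≡ d
    start d = trans (cong₂ (λ s t → d * + s + t) (cong (ℕ._+ 1) (ℕ.*-zeroʳ m)) (dot-0 (tail g)))
      (trans (+-identityʳ (d * 1ℤ)) (*-identityʳ d))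
    walk : Close (d ∷ 0ᵛ) → ∃ λ l → l ℕ.≤ 5 ℕ.* m ℕ.+ 4 × Walk (order m) (toList (generators m)) l i j
    walk (y , ‖y‖≤k , n∣) = ‖ y ‖ , ‖y‖≤k ,
      Circulant.vector⇒walk (ℕ.pred (order m)) (generators m) y i j
        (subst (λ d → + order m ∣ℤ.∣ dot y g - d) (start d) n∣)

-- The lower bound

+ᵛ-identityʳ : ∀ (x : Vec ℤ n) → x +ᵛ 0ᵛ ≡ x
+ᵛ-identityʳ []      = refl
+ᵛ-identityʳ (x ∷ xs) = cong₂ _∷_ (+-identityʳ x) (+ᵛ-identityʳ xs)

comb-+ˡ : ∀ (a b : Vec ℤ k) (R : Vec (Vec ℤ n) k) → comb (a +ᵛ b) R ≡ comb a R +ᵛ comb b R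
comb-+ˡ []       []       []      = sym (+ᵛ-identityʳ 0ᵛ)
comb-+ˡ (a ∷ as) (b ∷ bs) (r ∷ R) =
  trans (cong (_+ᵛ_ ((a + b) *ᵛ r)) (comb-+ˡ as bs R)) (go r (comb as R) (comb bs R))
  where
  go : ∀ {n} (r p q : Vec ℤ n) → (a + b) *ᵛ r +ᵛ (p +ᵛ q) ≡ (a *ᵛ r +ᵛ p) +ᵛ (b *ᵛ r +ᵛ q)
  go []      []      []      = refl
  go (r ∷ rs) (p ∷ ps) (q ∷ qs) = cong₂ _∷_ (distrib₊ a b r p q) (go rs ps qs)

comb-*ˡ : ∀ c (a : Vec ℤ k) (R : Vec (Vec ℤ n) k) → comb (c *ᵛ a) R ≡ c *ᵛ comb a R
comb-*ˡ c []       []      = go _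
  where
  go : ∀ n → 0ᵛ {n} ≡ c *ᵛ 0ᵛ
  go zero    = refl
  go (suc n) = cong₂ _∷_ (sym (*-zeroʳ c)) (go n)
comb-*ˡ c (a ∷ as) (r ∷ R) = trans (cong (_+ᵛ_ ((c * a) *ᵛ r)) (comb-*ˡ c as R)) (go r (comb as R))
  where
  go : ∀ {n} (r p : Vec ℤ n) → (c * a) *ᵛ r +ᵛ c *ᵛ p ≡ c *ᵛ (a *ᵛ r +ᵛ p)
  go []       []       = refl
  go (r ∷ rs) (p ∷ ps) = cong₂ _∷_ (distrib* c a r p) (go rs ps)

comb-0ˡ : ∀ (R : Vec (Vec ℤ n) k) → comb 0ᵛ R ≡ 0ᵛ
comb-0ˡ []      = refl
comb-0ˡ (r ∷ R) = trans (cong (_+ᵛ_ (0ℤ *ᵛ r)) (comb-0ˡ R)) (go r)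
  where
  go : ∀ {n} (r : Vec ℤ n) → 0ℤ *ᵛ r +ᵛ 0ᵛ ≡ 0ᵛ
  go []       = refl
  go (r ∷ rs) = cong (0ℤ ∷_) (go rs)

-- `comb c R` is the product of the row vector c with the matrix R, and this is associativity of the
-- product.
comb-assoc : ∀ {l} (c : Vec ℤ l) (A : Vec (Vec ℤ k) l) (R : Vec (Vec ℤ n) k) →
             comb c (map (λ a → comb a R) A) ≡ comb (comb c A) R
comb-assoc []       []      R = sym (comb-0ˡ R)
comb-assoc (c ∷ cs) (a ∷ A) R = begin
  c *ᵛ comb a R +ᵛ comb cs (map (λ a → comb a R) A) ≡⟨ cong₂ _+ᵛ_ (sym (comb-*ˡ c a R)) (comb-assoc cs A R) ⟩
  comb (c *ᵛ a) R +ᵛ comb (comb cs A) R             ≡⟨ sym (comb-+ˡ (c *ᵛ a) (comb cs A) R) ⟩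
  comb (c *ᵛ a +ᵛ comb cs A) R                      ∎
  where open ≡-Reasoning

comb-+ʳ : ∀ (c : Vec ℤ k) (R S : Vec (Vec ℤ n) k) → comb c (zipWith _+ᵛ_ R S) ≡ comb c R +ᵛ comb c S
comb-+ʳ []       []      []      = sym (+ᵛ-identityʳ 0ᵛ)
comb-+ʳ (c ∷ cs) (r ∷ R) (s ∷ S) =
  trans (cong (_+ᵛ_ (c *ᵛ (r +ᵛ s))) (comb-+ʳ cs R S)) (go r s (comb cs R) (comb cs S))
  where
  lem : ∀ c r s p q → c * (r + s) + (p + q) ≡ (c * r + p) + (c * s + q)
  lem = solve-∀
  go : ∀ {n} (r s p q : Vec ℤ n) → c *ᵛ (r +ᵛ s) +ᵛ (p +ᵛ q) ≡ (c *ᵛ r +ᵛ p) +ᵛ (c *ᵛ s +ᵛ q)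
  go []       []       []       []       = refl
  go (r ∷ rs) (s ∷ ss) (p ∷ ps) (q ∷ qs) = cong₂ _∷_ (lem c r s p q) (go rs ss ps qs)

diag : Vec ℤ n → Vec (Vec ℤ n) n
diag []       = []
diag (d ∷ ds) = (d ∷ 0ᵛ) ∷ map (0ℤ ∷_) (diag ds)

comb-diag : ∀ (c d : Vec ℤ n) → comb c (diag d) ≡ zipWith _*_ c d
comb-diag []       []       = refl
comb-diag (c ∷ cs) (d ∷ ds) = trans (cong (_+ᵛ_ (c *ᵛ (d ∷ 0ᵛ))) (trans (shift cs (diag ds)) (cong (0ℤ ∷_) (comb-diag cs ds))))
  (cong₂ _∷_ (+-identityʳ (c * d)) (zeros (zipWith _*_ cs ds)))
  where
  shift : ∀ {n k} (c : Vec ℤ k) (R : Vec (Vec ℤ n) k) → comb c (map (0ℤ ∷_) R) ≡ 0ℤ ∷ comb c R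
  shift []       []      = refl
  shift (c ∷ cs) (r ∷ R) = trans (cong (_+ᵛ_ (c *ᵛ (0ℤ ∷ r))) (shift cs R))
    (cong (_∷ (c *ᵛ r +ᵛ comb cs R)) (trans (+-identityʳ (c * 0ℤ)) (*-zeroʳ c)))
  zeros : ∀ {n} (x : Vec ℤ n) → c *ᵛ 0ᵛ +ᵛ x ≡ x
  zeros []       = refl
  zeros (x ∷ xs) = cong₂ _∷_ (trans (cong (_+ x) (*-zeroʳ c)) (+-identityˡ x)) (zeros xs)

⟦diagᴾ⟧ : ∀ (ds : Vec Poly n) m → ⟦ diagᴾ ds ⟧ᴹ m ≡ diag (⟦ ds ⟧ᵛ m)
⟦diagᴾ⟧ []       m = refl
⟦diagᴾ⟧ (d ∷ ds) m = cong₂ _∷_ (cong (⟦ d ⟧ m ∷_) (⟦0⟧ᵛ _ m)) (trans (shift (diagᴾ ds)) (cong (map (0ℤ ∷_)) (⟦diagᴾ⟧ ds m)))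
  where
  shift : ∀ {n k} (R : Vec (Vec Poly n) k) → ⟦ map ([] ∷_) R ⟧ᴹ m ≡ map (0ℤ ∷_) (⟦ R ⟧ᴹ m)
  shift []      = refl
  shift (r ∷ R) = cong (_ ∷_) (shift R)

⟦constᴹ⟧ : ∀ (R : Vec (Vec ℤ n) k) m → ⟦ map (map (_∷ [])) R ⟧ᴹ m ≡ R
⟦constᴹ⟧ []      m = refl
⟦constᴹ⟧ (r ∷ R) m = cong₂ _∷_ (consts r) (⟦constᴹ⟧ R m)
  where
  consts : ∀ {n} (r : Vec ℤ n) → ⟦ map (_∷ []) r ⟧ᵛ m ≡ r
  consts []      = refl
  consts (c ∷ r) = cong₂ _∷_ (⟦const⟧ c m) (consts r)

⟦⊕ᴹ⟧ : ∀ (R S : Vec (Vec Poly n) k) m → ⟦ zipWith _⊕ᵛ_ R S ⟧ᴹ m ≡ zipWith _+ᵛ_ (⟦ R ⟧ᴹ m) (⟦ S ⟧ᴹ m)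
⟦⊕ᴹ⟧ []      []      m = refl
⟦⊕ᴹ⟧ (r ∷ R) (s ∷ S) m = cong₂ _∷_ (⟦⊕ᵛ⟧ r s m) (⟦⊕ᴹ⟧ R S m)

diagonalℤ : ℕ → Vec ℤ 5
diagonalℤ m = map +_ (map (λ p → evalℕ p m) diagonal)

comb-V : ∀ a m → comb a (⟦ V ⟧ᴹ m) ≡ zipWith _*_ a (diagonalℤ m) +ᵛ comb a offDiagonal
comb-V a m = begin
  comb a (⟦ V ⟧ᴹ m)
    ≡⟨ cong (comb a) (⟦⊕ᴹ⟧ (diagᴾ (map pos diagonal)) (map (map (_∷ [])) offDiagonal) m) ⟩
  comb a (zipWith _+ᵛ_ (⟦ diagᴾ (map pos diagonal) ⟧ᴹ m) (⟦ map (map (_∷ [])) offDiagonal ⟧ᴹ m))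
    ≡⟨ cong₂ (λ R S → comb a (zipWith _+ᵛ_ R S))
         (trans (⟦diagᴾ⟧ (map pos diagonal) m) (cong diag (⟦map-pos⟧ diagonal m))) (⟦constᴹ⟧ offDiagonal m) ⟩
  comb a (zipWith _+ᵛ_ (diag (diagonalℤ m)) offDiagonal)
    ≡⟨ comb-+ʳ a (diag (diagonalℤ m)) offDiagonal ⟩
  comb a (diag (diagonalℤ m)) +ᵛ comb a offDiagonal
    ≡⟨ cong (_+ᵛ comb a offDiagonal) (comb-diag a (diagonalℤ m)) ⟩
  zipWith _*_ a (diagonalℤ m) +ᵛ comb a offDiagonal ∎
  where open ≡-Reasoning

-- Vectors far from the lattice

‖comb‖≤ : ∀ (a : Vec ℤ k) (R : Vec (Vec ℤ n) k) → ‖ comb a R ‖ ℕ.≤ weighted (map ‖_‖ R) a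
‖comb‖≤ {n = n} [] []    = ℕ.≤-reflexive (‖0‖ n)
‖comb‖≤ (a ∷ as) (r ∷ R) = begin
  ‖ a *ᵛ r +ᵛ comb as R ‖                    ≤⟨ ‖+‖≤ (a *ᵛ r) (comb as R) ⟩
  ‖ a *ᵛ r ‖ ℕ.+ ‖ comb as R ‖               ≤⟨ ℕ.+-mono-≤ (ℕ.≤-reflexive (scale r)) (‖comb‖≤ as R) ⟩
  ‖ r ‖ ℕ.* ∣ a ∣ ℕ.+ weighted (map ‖_‖ R) as ∎
  where
  open ℕ.≤-Reasoning
  scale : ∀ {n} (r : Vec ℤ n) → ‖ a *ᵛ r ‖ ≡ ‖ r ‖ ℕ.* ∣ a ∣
  scale []      = refl
  scale (x ∷ r) = trans (cong₂ ℕ._+_ (trans (∣i*j∣≡∣i∣*∣j∣ a x) (ℕ.*-comm ∣ a ∣ ∣ x ∣)) (scale r))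
    (sym (ℕ.*-distribʳ-+ ∣ a ∣ ∣ x ∣ ‖ r ‖))

‖‖≤‖+‖+‖‖ : ∀ (x y : Vec ℤ n) → ‖ x ‖ ℕ.≤ ‖ x +ᵛ y ‖ ℕ.+ ‖ y ‖
‖‖≤‖+‖+‖‖ []       []       = z≤n
‖‖≤‖+‖+‖‖ (x ∷ xs) (y ∷ ys) = begin
  ∣ x ∣ ℕ.+ ‖ xs ‖                                          ≡⟨ cong (λ t → ∣ t ∣ ℕ.+ ‖ xs ‖) (lem x y) ⟩
  ∣ x + y - y ∣ ℕ.+ ‖ xs ‖                                  ≤⟨ ℕ.+-mono-≤ (∣i-j∣≤∣i∣+∣j∣ (x + y) y) (‖‖≤‖+‖+‖‖ xs ys) ⟩
  (∣ x + y ∣ ℕ.+ ∣ y ∣) ℕ.+ (‖ xs +ᵛ ys ‖ ℕ.+ ‖ ys ‖)       ≡⟨ ℕ-interchange (∣ x + y ∣) ∣ y ∣ ‖ xs +ᵛ ys ‖ ‖ ys ‖ ⟩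
  (∣ x + y ∣ ℕ.+ ‖ xs +ᵛ ys ‖) ℕ.+ (∣ y ∣ ℕ.+ ‖ ys ‖)       ∎
  where
  open ℕ.≤-Reasoning
  lem : ∀ x y → x ≡ x + y - y
  lem = solve-∀

-- For a ≠ 0: |x + ad| ≥ |a||d| - |x| ≥ (2|x| + o)|a| - |x| ≥ |x| + o|a|. The surplus o|a| is
-- reserved for the off-diagonal part.
∣∣-slack : ∀ x a d o → 2 ℕ.* ∣ x ∣ ℕ.+ o ℕ.≤ ∣ d ∣ → ∣ x ∣ ℕ.+ o ℕ.* ∣ a ∣ ℕ.≤ ∣ x + a * d ∣
∣∣-slack x a d o slack = go ∣ a ∣ refl
  where
  open ℕ.≤-Reasoning
  regroup : ∀ x o b → (x ℕ.+ o ℕ.* b) ℕ.+ x ≡ 2 ℕ.* x ℕ.* 1 ℕ.+ o ℕ.* b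
  regroup = ℕ.solve-∀
  cancel : ∀ x p → p ≡ (x + p) - x
  cancel = solve-∀
  go : ∀ b → ∣ a ∣ ≡ b → ∣ x ∣ ℕ.+ o ℕ.* b ℕ.≤ ∣ x + a * d ∣
  go zero    eq = ℕ.≤-reflexive (trans (trans (cong (∣ x ∣ ℕ.+_) (ℕ.*-zeroʳ o)) (ℕ.+-identityʳ ∣ x ∣))
    (cong ∣_∣ (sym (trans (cong (λ a → x + a * d) (∣i∣≡0⇒i≡0 {a} eq)) (+-identityʳ x)))))
  go (suc b) eq = ℕ.+-cancelʳ-≤ ∣ x ∣ (∣ x ∣ ℕ.+ o ℕ.* suc b) (∣ x + a * d ∣) (begin
    (∣ x ∣ ℕ.+ o ℕ.* suc b) ℕ.+ ∣ x ∣      ≡⟨ regroup ∣ x ∣ o (suc b) ⟩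
    2 ℕ.* ∣ x ∣ ℕ.* 1 ℕ.+ o ℕ.* suc b      ≤⟨ ℕ.+-monoˡ-≤ (o ℕ.* suc b) (ℕ.*-monoʳ-≤ (2 ℕ.* ∣ x ∣) (s≤s z≤n)) ⟩
    2 ℕ.* ∣ x ∣ ℕ.* suc b ℕ.+ o ℕ.* suc b  ≡⟨ sym (ℕ.*-distribʳ-+ (suc b) (2 ℕ.* ∣ x ∣) o) ⟩
    (2 ℕ.* ∣ x ∣ ℕ.+ o) ℕ.* suc b          ≤⟨ ℕ.*-monoˡ-≤ (suc b) slack ⟩
    ∣ d ∣ ℕ.* suc b                        ≡⟨ trans (ℕ.*-comm ∣ d ∣ (suc b)) (cong (ℕ._* ∣ d ∣) (sym eq)) ⟩
    ∣ a ∣ ℕ.* ∣ d ∣                        ≡⟨ sym (∣i*j∣≡∣i∣*∣j∣ a d) ⟩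
    ∣ a * d ∣                              ≡⟨ cong ∣_∣ (cancel x (a * d)) ⟩
    ∣ (x + a * d) - x ∣                    ≤⟨ ∣i-j∣≤∣i∣+∣j∣ (x + a * d) x ⟩
    ∣ x + a * d ∣ ℕ.+ ∣ x ∣                ∎)

Slack : Vec ℤ n → Vec ℤ n → Vec ℕ n → Set
Slack []       []       []       = ⊤
Slack (x ∷ xs) (d ∷ ds) (o ∷ os) = 2 ℕ.* ∣ x ∣ ℕ.+ o ℕ.≤ ∣ d ∣ × Slack xs ds os

‖‖-slack : ∀ (x a d : Vec ℤ n) o → Slack x d o → ‖ x ‖ ℕ.+ weighted o a ℕ.≤ ‖ x +ᵛ zipWith _*_ a d ‖
‖‖-slack []       []       []       []       _        = z≤n
‖‖-slack (x ∷ xs) (a ∷ as) (d ∷ ds) (o ∷ os) (s , ss) = begin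
  (∣ x ∣ ℕ.+ ‖ xs ‖) ℕ.+ (o ℕ.* ∣ a ∣ ℕ.+ weighted os as) ≡⟨ ℕ-interchange ∣ x ∣ ‖ xs ‖ (o ℕ.* ∣ a ∣) (weighted os as) ⟩
  (∣ x ∣ ℕ.+ o ℕ.* ∣ a ∣) ℕ.+ (‖ xs ‖ ℕ.+ weighted os as) ≤⟨ ℕ.+-mono-≤ (∣∣-slack x a d o s) (‖‖-slack xs as ds os ss) ⟩
  ∣ x + a * d ∣ ℕ.+ ‖ xs +ᵛ zipWith _*_ as ds ‖           ∎
  where
  open ℕ.≤-Reasoning

+ᵛ-assoc : ∀ (x y z : Vec ℤ n) → (x +ᵛ y) +ᵛ z ≡ x +ᵛ (y +ᵛ z)
+ᵛ-assoc = zipWith-assoc +-assoc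

-- The diagonal part lengthens x by at least Σ oᵢ|aᵢ|, where oᵢ is the norm of the i-th off-diagonal
-- row; the off-diagonal part can take back at most this much.
‖‖≤‖+V‖ : ∀ m x → Slack x (diagonalℤ m) (map ‖_‖ offDiagonal) → ∀ a → ‖ x ‖ ℕ.≤ ‖ x +ᵛ comb a (⟦ V ⟧ᴹ m) ‖
‖‖≤‖+V‖ m x slack a = ℕ.+-cancelʳ-≤ (weighted (map ‖_‖ offDiagonal) a) ‖ x ‖ ‖ x +ᵛ comb a (⟦ V ⟧ᴹ m) ‖ (begin
  ‖ x ‖ ℕ.+ o                           ≤⟨ ‖‖-slack x a (diagonalℤ m) (map ‖_‖ offDiagonal) slack ⟩
  ‖ x +ᵛ p ‖                            ≤⟨ ‖‖≤‖+‖+‖‖ (x +ᵛ p) q ⟩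
  ‖ (x +ᵛ p) +ᵛ q ‖ ℕ.+ ‖ q ‖           ≤⟨ ℕ.+-monoʳ-≤ ‖ (x +ᵛ p) +ᵛ q ‖ (‖comb‖≤ a offDiagonal) ⟩
  ‖ (x +ᵛ p) +ᵛ q ‖ ℕ.+ o               ≡⟨ cong (λ t → ‖ t ‖ ℕ.+ o) (trans (+ᵛ-assoc x p q) (cong (x +ᵛ_) (sym (comb-V a m)))) ⟩
  ‖ x +ᵛ comb a (⟦ V ⟧ᴹ m) ‖ ℕ.+ o      ∎)
  where
  open ℕ.≤-Reasoning
  o = weighted (map ‖_‖ offDiagonal) a
  p = zipWith _*_ a (diagonalℤ m)
  q = comb a offDiagonal

-- A basis of the kernel

W : Vec (Vec Poly 5) 5
W = w ∷ tail V

-- The Hermite normal form of a basis of the kernel, read off from g₁ = 1.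
H : Vec (Vec Poly 5) 5
H = (pos orderᴾ ∷ [] ∷ [] ∷ [] ∷ [] ∷ [])
  ∷ (-1ℤ ⊙ pos (lookup generatorsᴾ y₂) ∷ (1ℤ ∷ []) ∷ [] ∷ [] ∷ [] ∷ [])
  ∷ (-1ℤ ⊙ pos (lookup generatorsᴾ y₃) ∷ [] ∷ (1ℤ ∷ []) ∷ [] ∷ [] ∷ [])
  ∷ (-1ℤ ⊙ pos (lookup generatorsᴾ y₄) ∷ [] ∷ [] ∷ (1ℤ ∷ []) ∷ [] ∷ [])
  ∷ (-1ℤ ⊙ pos (lookup generatorsᴾ y₅) ∷ [] ∷ [] ∷ [] ∷ (1ℤ ∷ []) ∷ [])
  ∷ []

-- U = H W⁻¹, a unimodular matrix.
U : Vec (Vec Poly 5) 5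
U =
  ((+ 185 ∷ + 760 ∷ + 1216 ∷ + 896 ∷ + 256 ∷ [])
  ∷ (-[1+ 101 ] ∷ -[1+ 429 ] ∷ -[1+ 679 ] ∷ -[1+ 479 ] ∷ -[1+ 127 ] ∷ [])
  ∷ (-[1+ 53 ] ∷ -[1+ 269 ] ∷ -[1+ 503 ] ∷ -[1+ 415 ] ∷ -[1+ 127 ] ∷ [])
  ∷ (-[1+ 78 ] ∷ -[1+ 325 ] ∷ -[1+ 535 ] ∷ -[1+ 415 ] ∷ -[1+ 127 ] ∷ [])
  ∷ (-[1+ 117 ] ∷ -[1+ 461 ] ∷ -[1+ 695 ] ∷ -[1+ 479 ] ∷ -[1+ 127 ] ∷ [])
  ∷ []) ∷
  ((-[1+ 13 ] ∷ -[1+ 27 ] ∷ -[1+ 15 ] ∷ [])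
  ∷ (+ 8 ∷ + 16 ∷ + 8 ∷ [])
  ∷ (+ 4 ∷ + 12 ∷ + 8 ∷ [])
  ∷ (+ 6 ∷ + 12 ∷ + 8 ∷ [])
  ∷ (+ 9 ∷ + 16 ∷ + 8 ∷ [])
  ∷ []) ∷
  ((-[1+ 46 ] ∷ -[1+ 143 ] ∷ -[1+ 159 ] ∷ -[1+ 63 ] ∷ [])
  ∷ (+ 26 ∷ + 82 ∷ + 88 ∷ + 32 ∷ [])
  ∷ (+ 14 ∷ + 54 ∷ + 72 ∷ + 32 ∷ [])
  ∷ (+ 20 ∷ + 62 ∷ + 72 ∷ + 32 ∷ [])
  ∷ (+ 30 ∷ + 86 ∷ + 88 ∷ + 32 ∷ [])
  ∷ []) ∷
  ((-[1+ 57 ] ∷ -[1+ 167 ] ∷ -[1+ 175 ] ∷ -[1+ 63 ] ∷ [])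
  ∷ (+ 32 ∷ + 96 ∷ + 96 ∷ + 32 ∷ [])
  ∷ (+ 17 ∷ + 64 ∷ + 80 ∷ + 32 ∷ [])
  ∷ (+ 25 ∷ + 72 ∷ + 80 ∷ + 32 ∷ [])
  ∷ (+ 37 ∷ + 100 ∷ + 96 ∷ + 32 ∷ [])
  ∷ []) ∷
  ((-[1+ 88 ] ∷ -[1+ 283 ] ∷ -[1+ 319 ] ∷ -[1+ 127 ] ∷ [])
  ∷ (+ 49 ∷ + 162 ∷ + 176 ∷ + 64 ∷ [])
  ∷ (+ 26 ∷ + 106 ∷ + 144 ∷ + 64 ∷ [])
  ∷ (+ 38 ∷ + 122 ∷ + 144 ∷ + 64 ∷ [])
  ∷ (+ 57 ∷ + 170 ∷ + 176 ∷ + 64 ∷ [])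
  ∷ []) ∷ []

_≅ᵛ_ : Vec Poly n → Vec Poly n → Bool
[]       ≅ᵛ []       = true
(p ∷ ps) ≅ᵛ (q ∷ qs) = (p ≅ q) ∧ (ps ≅ᵛ qs)

≅ᵛ-sound : ∀ (ps qs : Vec Poly n) {m} → T (ps ≅ᵛ qs) → ⟦ ps ⟧ᵛ m ≡ ⟦ qs ⟧ᵛ m
≅ᵛ-sound []       []       t = refl
≅ᵛ-sound (p ∷ ps) (q ∷ qs) t with ∧-elim {p ≅ q} t
... | p≅q , ps≅qs = cong₂ _∷_ (≅-sound p q p≅q) (≅ᵛ-sound ps qs ps≅qs)

factorᵇ : Vec (Vec Poly n) k → Vec (Vec Poly 5) k → Vec (Vec Poly n) 5 → Bool
factorᵇ []      []      R = true
factorᵇ (r ∷ X) (u ∷ Y) R = (r ≅ᵛ combᴾ u R) ∧ factorᵇ X Y R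

factor-sound : ∀ (X : Vec (Vec Poly n) k) Y R {m} → T (factorᵇ X Y R) →
               ⟦ X ⟧ᴹ m ≡ map (λ a → comb a (⟦ R ⟧ᴹ m)) (⟦ Y ⟧ᴹ m)
factor-sound []      []      R     t = refl
factor-sound (r ∷ X) (u ∷ Y) R {m} t with ∧-elim {r ≅ᵛ combᴾ u R} t
... | t₁ , t₂ = cong₂ _∷_ (trans (≅ᵛ-sound r (combᴾ u R) t₁) (⟦combᴾ⟧ u R m)) (factor-sound X Y R t₂)

module _ (m : ℕ) where

  private
    g = map +_ (generators m)
    w′ = ⟦ w ⟧ᵛ m
    V′ = ⟦ V ⟧ᴹ m

  -- Because g₁ = 1, the last four coordinates are free and the first is tn - Σ zᵢgᵢ, summed over i
  -- ≥ 2.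
  kernel⇒H : ∀ (z : Vec ℤ 5) t → dot z g ≡ t * + order m → z ≡ comb (t ∷ tail z) (⟦ H ⟧ᴹ m)
  kernel⇒H z@(z₁ ∷ z₂ ∷ z₃ ∷ z₄ ∷ z₅ ∷ []) t eq = begin
    z ≡⟨ cong₂ _∷_ first (cong₂ _∷_ (lem₂ t z₂ z₃ z₄ z₅ (+ m)) (cong₂ _∷_ (lem₃ t z₂ z₃ z₄ z₅ (+ m))
           (cong₂ _∷_ (lem₄ t z₂ z₃ z₄ z₅ (+ m)) (cong₂ _∷_ (lem₅ t z₂ z₃ z₄ z₅ (+ m)) refl)))) ⟩
    comb (t ∷ tail z) (⟦ H ⟧ᴹ m) ∎
    where
    open ≡-Reasoning
    γ : Fin 5 → Poly
    γ i = pos (lookup generatorsᴾ i)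
    lem₁ : ∀ z₁ z₂ z₃ z₄ z₅ m g₂ g₃ g₄ g₅ →
      z₁ ≡ (z₁ * (1ℤ + m * 0ℤ) + (z₂ * g₂ + (z₃ * g₃ + (z₄ * g₄ + (z₅ * g₅ + 0ℤ)))))
        + (z₂ * (-1ℤ * g₂) + (z₃ * (-1ℤ * g₃) + (z₄ * (-1ℤ * g₄) + (z₅ * (-1ℤ * g₅) + 0ℤ))))
    lem₁ = solve-∀
    lem₂ : ∀ t z₂ z₃ z₄ z₅ m → z₂ ≡ t * 0ℤ + (z₂ * (1ℤ + m * 0ℤ) + (z₃ * 0ℤ + (z₄ * 0ℤ + (z₅ * 0ℤ + 0ℤ))))
    lem₂ = solve-∀
    lem₃ : ∀ t z₂ z₃ z₄ z₅ m → z₃ ≡ t * 0ℤ + (z₂ * 0ℤ + (z₃ * (1ℤ + m * 0ℤ) + (z₄ * 0ℤ + (z₅ * 0ℤ + 0ℤ))))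
    lem₃ = solve-∀
    lem₄ : ∀ t z₂ z₃ z₄ z₅ m → z₄ ≡ t * 0ℤ + (z₂ * 0ℤ + (z₃ * 0ℤ + (z₄ * (1ℤ + m * 0ℤ) + (z₅ * 0ℤ + 0ℤ))))
    lem₄ = solve-∀
    lem₅ : ∀ t z₂ z₃ z₄ z₅ m → z₅ ≡ t * 0ℤ + (z₂ * 0ℤ + (z₃ * 0ℤ + (z₄ * 0ℤ + (z₅ * (1ℤ + m * 0ℤ) + 0ℤ))))
    lem₅ = solve-∀
    tail₁ : Vec ℤ 4 → ℤ
    tail₁ (a ∷ b ∷ c ∷ d ∷ []) = z₂ * a + (z₃ * b + (z₄ * c + (z₅ * d + 0ℤ)))
    first : z₁ ≡ t * ⟦ pos orderᴾ ⟧ m + tail₁ (map (λ i → ⟦ -1ℤ ⊙ γ i ⟧ m) (y₂ ∷ y₃ ∷ y₄ ∷ y₅ ∷ []))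
    first = begin
      z₁
        ≡⟨ lem₁ z₁ z₂ z₃ z₄ z₅ (+ m) (⟦ γ y₂ ⟧ m) (⟦ γ y₃ ⟧ m) (⟦ γ y₄ ⟧ m) (⟦ γ y₅ ⟧ m) ⟩
      dot z (⟦ map pos generatorsᴾ ⟧ᵛ m) + tail₁ (map (λ i → -1ℤ * ⟦ γ i ⟧ m) (y₂ ∷ y₃ ∷ y₄ ∷ y₅ ∷ []))
        ≡⟨ cong₂ (λ s v → s + tail₁ v)
             (trans (cong (dot z) (⟦map-pos⟧ generatorsᴾ m)) (trans eq (cong (_*_ t) (sym (⟦order⟧ m)))))
             (map-cong (λ i → sym (⟦⊙⟧ (-1ℤ) (γ i) m)) (y₂ ∷ y₃ ∷ y₄ ∷ y₅ ∷ [])) ⟩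
      t * ⟦ pos orderᴾ ⟧ m + tail₁ (map (λ i → ⟦ -1ℤ ⊙ γ i ⟧ m) (y₂ ∷ y₃ ∷ y₄ ∷ y₅ ∷ [])) ∎

  -- `W` is a basis of L ∪ (w + L), since V₁ = 2w - V₂ - V₃ - V₄ - V₅. The identity H = UW, checked
  -- coefficientwise, turns coefficients over `H` into coefficients over `W`.
  kernel⇒W : ∀ (z : Vec ℤ 5) → + order m ∣ℤ.∣ dot z g → ∃ λ c → z ≡ comb c (⟦ W ⟧ᴹ m)
  kernel⇒W z (divides t eq) = comb (t ∷ tail z) (⟦ U ⟧ᴹ m) , (begin
    z                                                                    ≡⟨ kernel⇒H z t eq ⟩
    comb (t ∷ tail z) (⟦ H ⟧ᴹ m)                                          ≡⟨ cong (comb (t ∷ tail z)) (factor-sound H U W {m} tt) ⟩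
    comb (t ∷ tail z) (map (λ a → comb a (⟦ W ⟧ᴹ m)) (⟦ U ⟧ᴹ m))          ≡⟨ comb-assoc (t ∷ tail z) (⟦ U ⟧ᴹ m) (⟦ W ⟧ᴹ m) ⟩
    comb (comb (t ∷ tail z) (⟦ U ⟧ᴹ m)) (⟦ W ⟧ᴹ m)                        ∎)
    where open ≡-Reasoning

  2w≡ΣV : comb (replicate 5 1ℤ) V′ ≡ + 2 *ᵛ w′
  2w≡ΣV = begin
    comb (replicate 5 1ℤ) V′                        ≡⟨ cong (λ o → comb (replicate 5 o) V′) (sym (⟦const⟧ 1ℤ m)) ⟩
    comb (⟦ replicate 5 (1ℤ ∷ []) ⟧ᵛ m) V′          ≡⟨ sym (⟦combᴾ⟧ (replicate 5 (1ℤ ∷ [])) V m) ⟩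
    ⟦ combᴾ (replicate 5 (1ℤ ∷ [])) V ⟧ᵛ m          ≡⟨ ≅ᵛ-sound (combᴾ (replicate 5 (1ℤ ∷ [])) V) (map (+ 2 ⊙_) w) {m} tt ⟩
    ⟦ map (+ 2 ⊙_) w ⟧ᵛ m                           ≡⟨ scale w ⟩
    + 2 *ᵛ w′                                       ∎
    where
    open ≡-Reasoning
    scale : ∀ {n} (r : Vec Poly n) → ⟦ map (+ 2 ⊙_) r ⟧ᵛ m ≡ + 2 *ᵛ ⟦ r ⟧ᵛ m
    scale []      = refl
    scale (p ∷ r) = cong₂ _∷_ (⟦⊙⟧ (+ 2) p m) (scale r)

  even-W : ∀ q cs → comb ((q * + 2) ∷ cs) (⟦ W ⟧ᴹ m) ≡ comb (q *ᵛ replicate 5 1ℤ +ᵛ (0ℤ ∷ cs)) V′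
  even-W q cs = sym (begin
    comb (q *ᵛ replicate 5 1ℤ +ᵛ (0ℤ ∷ cs)) V′                 ≡⟨ comb-+ˡ (q *ᵛ replicate 5 1ℤ) (0ℤ ∷ cs) V′ ⟩
    comb (q *ᵛ replicate 5 1ℤ) V′ +ᵛ comb (0ℤ ∷ cs) V′         ≡⟨ cong (_+ᵛ comb (0ℤ ∷ cs) V′) (trans (comb-*ˡ q (replicate 5 1ℤ) V′) (cong (q *ᵛ_) 2w≡ΣV)) ⟩
    q *ᵛ (+ 2 *ᵛ w′) +ᵛ (0ℤ *ᵛ row m y₁ +ᵛ comb cs (tail V′))  ≡⟨ go w′ (row m y₁) (comb cs (tail V′)) ⟩
    (q * + 2) *ᵛ w′ +ᵛ comb cs (tail V′)                       ∎)
    where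
    open ≡-Reasoning
    lem : ∀ q w v p → q * (+ 2 * w) + (0ℤ * v + p) ≡ (q * + 2) * w + p
    lem = solve-∀
    go : ∀ {n} (w v p : Vec ℤ n) → q *ᵛ (+ 2 *ᵛ w) +ᵛ (0ℤ *ᵛ v +ᵛ p) ≡ (q * + 2) *ᵛ w +ᵛ p
    go []       []       []       = refl
    go (w ∷ ws) (v ∷ vs) (p ∷ ps) = cong₂ _∷_ (lem q w v p) (go ws vs ps)

  -- As 2w = Σ V, the parity of the coefficient of w decides the coset. An odd coefficient 2q + 1 is
  -- written as 2(q + 1) - 1, because hole - w is short while hole + w is not.
  W⇒V : ∀ c → ∃ λ a → comb c (⟦ W ⟧ᴹ m) ≡ comb a V′ ⊎ comb c (⟦ W ⟧ᴹ m) ≡ comb a V′ -ᵛ w′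
  W⇒V (c ∷ cs) = go (c %ℕ 2) (n%ℕd<d c 2) (a≡a%ℕn+[a/ℕn]*n c 2)
    where
    q = c /ℕ 2
    go : ∀ r → r ℕ.< 2 → c ≡ + r + q * + 2 →
         ∃ λ a → comb (c ∷ cs) (⟦ W ⟧ᴹ m) ≡ comb a V′ ⊎ comb (c ∷ cs) (⟦ W ⟧ᴹ m) ≡ comb a V′ -ᵛ w′
    go 0 _ eq = q *ᵛ replicate 5 1ℤ +ᵛ (0ℤ ∷ cs) , inj₁ (trans (cong (λ c → comb (c ∷ cs) (⟦ W ⟧ᴹ m)) (trans eq (+-identityˡ (q * + 2)))) (even-W q cs))
    go 1 _ eq = (q + 1ℤ) *ᵛ replicate 5 1ℤ +ᵛ (0ℤ ∷ cs) , inj₂ (trans (pred w′ (comb cs (tail V′))) (cong (_-ᵛ w′) (even-W (q + 1ℤ) cs)))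
      where
      lem : ∀ q w p → (1ℤ + q * + 2) * w + p ≡ (((q + 1ℤ) * + 2) * w + p) - w
      lem = solve-∀
      pred : ∀ {n} (w p : Vec ℤ n) → c *ᵛ w +ᵛ p ≡ (((q + 1ℤ) * + 2) *ᵛ w +ᵛ p) -ᵛ w
      pred []       []       = refl
      pred (w ∷ ws) (p ∷ ps) = cong₂ _∷_ (trans (cong (λ c → c * w + p) eq) (lem q w p)) (pred ws ps)
    go (suc (suc _)) (s≤s (s≤s ()))

-- A point at distance k from the lattice

module _ (m : ℕ) where

  private
    g = map +_ (generators m)
    w′ = ⟦ w ⟧ᵛ m
    V′ = ⟦ V ⟧ᴹ m
    open Circulant (ℕ.pred (order m))

  diameter-≥ : ∀ t → (∀ y → + order m ∣ℤ.∣ dot y g - t → 5 ℕ.* m ℕ.+ 4 ℕ.≤ ‖ y ‖) →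
    ∃ λ i → ∃ λ j → (l : ℕ) → Walk (order m) (toList (generators m)) l i j → 5 ℕ.* m ℕ.+ 4 ℕ.≤ l
  diameter-≥ t far = vertex 0ℤ , vertex t , λ l walk → bound (walk⇒vector (generators m) walk)
    where
    i = + toℕ (vertex 0ℤ)
    j = + toℕ (vertex t)
    lem : ∀ d i j t → ((d - (j - i)) + (j - t)) - (i - 0ℤ) ≡ d - t
    lem = solve-∀
    bound : ∀ {l} → (∃ λ y → ‖ y ‖ ℕ.≤ l × + order m ∣ℤ.∣ dot y g - (j - i)) → 5 ℕ.* m ℕ.+ 4 ℕ.≤ l
    bound (y , ‖y‖≤l , n∣) = ℕ.≤-trans (far y (subst (+ order m ∣ℤ.∣_) (lem (dot y g) i j t)
      (∣m∣n⇒∣m-n (∣m∣n⇒∣m+n n∣ (toℕ-vertex t)) (toℕ-vertex 0ℤ)))) ‖y‖≤l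

  -- Half of w, with the one half-integral entry rounded down. Thus ‖hole‖ = k and ‖hole - w‖ = k +
  -- 1, which add up to ‖w‖ = 2k + 1.
  hole : Vec ℤ 5
  hole = + suc m ∷ + suc m ∷ + m ∷ + suc m ∷ + suc m ∷ []

  ‖hole‖ : ‖ hole ‖ ≡ 5 ℕ.* m ℕ.+ 4
  ‖hole‖ = lem m
    where
    lem : ∀ m → suc m ℕ.+ (suc m ℕ.+ (m ℕ.+ (suc m ℕ.+ (suc m ℕ.+ 0)))) ≡ 5 ℕ.* m ℕ.+ 4
    lem = ℕ.solve-∀

  hole-w : hole -ᵛ w′ ≡ replicate 5 -[1+ m ]
  hole-w = cong₂ _∷_ (lem (+ m)) (cong₂ _∷_ (lem (+ m)) (cong₂ _∷_ (lem′ (+ m)) (cong₂ _∷_ (lem (+ m)) (cong₂ _∷_ (lem (+ m)) refl))))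
    where
    lem : ∀ m → (1ℤ + m) - (+ 2 + m * (+ 2 + m * 0ℤ)) ≡ - (1ℤ + m)
    lem = solve-∀
    lem′ : ∀ m → m - (+ 1 + m * (+ 2 + m * 0ℤ)) ≡ - (1ℤ + m)
    lem′ = solve-∀

  far-hole : 1 ℕ.≤ m → ∀ y → + order m ∣ℤ.∣ dot y g - dot hole g → 5 ℕ.* m ℕ.+ 4 ℕ.≤ ‖ y ‖
  far-hole 1≤m y n∣ = lattice (kernel⇒W m (y -ᵛ hole) (subst (+ order m ∣ℤ.∣_) (sym (dot-- y hole g)) n∣))
    where
    -- This is where m ≥ 1 enters. The constant terms 4, 3, 3, 4, 4 of the diagonal then suffice for
    -- the off-diagonal norms 4, 3, 3, 2, 2.
    2[m+1]≤4m : 2 ℕ.* suc m ℕ.≤ m ℕ.* (m ℕ.* 0 ℕ.+ 4)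
    2[m+1]≤4m = subst₂ ℕ._≤_ (lem₁ m) (lem₂ m) (ℕ.+-monoʳ-≤ (2 ℕ.* m) (ℕ.*-monoʳ-≤ 2 1≤m))
      where
      lem₁ : ∀ m → 2 ℕ.* m ℕ.+ 2 ≡ 2 ℕ.* suc m
      lem₁ = ℕ.solve-∀
      lem₂ : ∀ m → 2 ℕ.* m ℕ.+ 2 ℕ.* m ≡ m ℕ.* (m ℕ.* 0 ℕ.+ 4)
      lem₂ = ℕ.solve-∀
    slack : ∀ {x o c} → x ℕ.≤ suc m → o ℕ.≤ c → 2 ℕ.* x ℕ.+ o ℕ.≤ m ℕ.* (m ℕ.* 0 ℕ.+ 4) ℕ.+ c
    slack x≤m+1 o≤c = ℕ.+-mono-≤ (ℕ.≤-trans (ℕ.*-monoʳ-≤ 2 x≤m+1) 2[m+1]≤4m) o≤c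
    offNorms = map ‖_‖ offDiagonal
    hole-slack : Slack hole (diagonalℤ m) offNorms
    hole-slack = slack ℕ.≤-refl (ℕ.m≤m+n 4 0) , slack ℕ.≤-refl (ℕ.m≤m+n 3 0) , slack (ℕ.n≤1+n m) (ℕ.m≤m+n 3 0)
      , slack ℕ.≤-refl (ℕ.m≤m+n 2 2) , slack ℕ.≤-refl (ℕ.m≤m+n 2 2) , tt
    hole′-slack : Slack (replicate 5 -[1+ m ]) (diagonalℤ m) offNorms
    hole′-slack = slack ℕ.≤-refl (ℕ.m≤m+n 4 0) , slack ℕ.≤-refl (ℕ.m≤m+n 3 0) , slack ℕ.≤-refl (ℕ.m≤m+n 3 0)
      , slack ℕ.≤-refl (ℕ.m≤m+n 2 2) , slack ℕ.≤-refl (ℕ.m≤m+n 2 2) , tt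
    k≤‖hole′‖ : 5 ℕ.* m ℕ.+ 4 ℕ.≤ ‖ replicate 5 -[1+ m ] ‖
    k≤‖hole′‖ = subst (5 ℕ.* m ℕ.+ 4 ℕ.≤_) (lem m) (ℕ.n≤1+n (5 ℕ.* m ℕ.+ 4))
      where
      lem : ∀ m → suc (5 ℕ.* m ℕ.+ 4) ≡ suc m ℕ.+ (suc m ℕ.+ (suc m ℕ.+ (suc m ℕ.+ (suc m ℕ.+ 0))))
      lem = ℕ.solve-∀
    regroup : ∀ {n} (y x : Vec ℤ n) {v} → y -ᵛ x ≡ v → x +ᵛ v ≡ y
    regroup y x refl = go y x
      where
      lem : ∀ y x → x + (y - x) ≡ y
      lem = solve-∀
      go : ∀ {n} (y x : Vec ℤ n) → x +ᵛ (y -ᵛ x) ≡ y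
      go []       []       = refl
      go (y ∷ ys) (x ∷ xs) = cong₂ _∷_ (lem y x) (go ys xs)
    exchange : ∀ {n} (x w v : Vec ℤ n) → (x -ᵛ w) +ᵛ v ≡ x +ᵛ (v -ᵛ w)
    exchange []       []       []       = refl
    exchange (x ∷ xs) (w ∷ ws) (v ∷ vs) = cong₂ _∷_ (lem x w v) (exchange xs ws vs)
      where
      lem : ∀ x w v → (x - w) + v ≡ x + (v - w)
      lem = solve-∀
    cases : ∀ {z} → y -ᵛ hole ≡ z → (∃ λ a → z ≡ comb a V′ ⊎ z ≡ comb a V′ -ᵛ w′) → 5 ℕ.* m ℕ.+ 4 ℕ.≤ ‖ y ‖
    cases z≡ (a , inj₁ eq) = subst₂ ℕ._≤_ ‖hole‖ (cong ‖_‖ (regroup y hole (trans z≡ eq)))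
      (‖‖≤‖+V‖ m hole hole-slack a)
    cases z≡ (a , inj₂ eq) = ℕ.≤-trans k≤‖hole′‖ (subst (‖ replicate 5 -[1+ m ] ‖ ℕ.≤_)
      (cong ‖_‖ (trans (cong (_+ᵛ comb a V′) (sym hole-w))
        (trans (exchange hole w′ (comb a V′)) (regroup y hole (trans z≡ eq)))))
      (‖‖≤‖+V‖ m (replicate 5 -[1+ m ]) hole′-slack a))
    lattice : (∃ λ c → y -ᵛ hole ≡ comb c (⟦ W ⟧ᴹ m)) → 5 ℕ.* m ℕ.+ 4 ℕ.≤ ‖ y ‖
    lattice (c , eq) = cases eq (W⇒V m c)

-- Exhaustive search in a small ball

allAbs≤ : ℕ → (ℤ → Bool) → Bool
allAbs≤ zero    p = p 0ℤ
allAbs≤ (suc b) p = (p (+ suc b) ∧ p -[1+ b ]) ∧ allAbs≤ b p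

allAbs≤-sound : ∀ b p x → ∣ x ∣ ℕ.≤ b → T (allAbs≤ b p) → T (p x)
allAbs≤-sound zero    p (+ zero) x≤b t = t
allAbs≤-sound (suc b) p x x≤1+b t with ∧-elim {p (+ suc b) ∧ p -[1+ b ]} t | ℕ.m≤n⇒m<n∨m≡n x≤1+b
... | _ , t′ | inj₁ (s≤s x≤b) = allAbs≤-sound b p x x≤b t′
allAbs≤-sound (suc b) p (+ .(suc b)) x≤1+b t | t′ , _ | inj₂ refl = proj₁ (∧-elim {p (+ suc b)} t′)
allAbs≤-sound (suc b) p -[1+ .b ]    x≤1+b t | t′ , _ | inj₂ refl = proj₂ (∧-elim {p (+ suc b)} t′)

-- A search over one coordinate at a time: `b` is the norm still available, and `s` is the sum
-- accumulated so far, which must not be completed to a multiple of N.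
avoids : (N : ℕ) .{{_ : ℕ.NonZero N}} → Vec ℤ n → ℕ → ℤ → Bool
avoids N []       b s = not (s %ℕ N ℕ.≡ᵇ 0)
avoids N (g ∷ gs) b s = allAbs≤ b (λ x → avoids N gs (b ℕ.∸ ∣ x ∣) (s + x * g))

avoids-sound : ∀ N .{{_ : ℕ.NonZero N}} (gs : Vec ℤ n) b s → T (avoids N gs b s) →
               ∀ y → ‖ y ‖ ℕ.≤ b → ¬ (+ N ∣ℤ.∣ s + dot y gs)
avoids-sound N []       b s t []      _     N∣ =
  subst (λ r → T (not (r ℕ.≡ᵇ 0))) (trans (%ℕ-cong s 0ℤ N∣) (ℕ.m<n⇒m%n≡m (ℕ.>-nonZero⁻¹ N))) t
avoids-sound N (g ∷ gs) b s t (x ∷ y) ‖xy‖≤b N∣ = avoids-sound N gs (b ℕ.∸ ∣ x ∣) (s + x * g)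
  (allAbs≤-sound b (λ x → avoids N gs (b ℕ.∸ ∣ x ∣) (s + x * g)) x (ℕ.m+n≤o⇒m≤o ∣ x ∣ ‖xy‖≤b) t) y
  (subst (ℕ._≤ b ℕ.∸ ∣ x ∣) (ℕ.m+n∸m≡n ∣ x ∣ ‖ y ‖) (ℕ.∸-monoˡ-≤ ∣ x ∣ ‖xy‖≤b))
  (subst (+ N ∣ℤ.∣_) (sym (+-assoc s (x * g) (dot y gs))) N∣)

-- The slack needed in far-hole is missing for m = 0, where n = 457; there the ball
-- of radius 3 is searched.
far-4 : ∀ y → + order 0 ∣ℤ.∣ dot y (map +_ (generators 0)) - + 4 → 4 ℕ.≤ ‖ y ‖
far-4 y n∣ = ℕ.≮⇒≥ λ { (s≤s ‖y‖≤3) → avoids-sound 457 (map +_ (generators 0)) 3 (- + 4) tt y ‖y‖≤3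
  (subst (+ 457 ∣ℤ.∣_) (+-comm (dot y (map +_ (generators 0))) (- + 4)) n∣) }

hasDiameter : ∀ m → HasDiameter (order m) (toList (generators m)) (5 ℕ.* m ℕ.+ 4)
hasDiameter zero      = diameter-≤ 0 , diameter-≥ 0 (+ 4) far-4
hasDiameter m@(suc _) = diameter-≤ m , diameter-≥ m (dot (hole m) (map +_ (generators m))) (far-hole m (s≤s z≤n))

-- Substituting k = 5m + 4 in the stated polynomials

module _ (m : ℕ) where
  open +-*-Solver

  private
    -- Repeats the recursion of `evalℕ` in the syntax of the solver, so that the solved equation is
    -- definitionally the required one.
    horner : ∀ {n} → List ℕ → Polynomial n → Polynomial n
    horner []      x = con 0
    horner (c ∷ p) x = x :* horner p x :+ con c

    κ = 5 ℕ.* m ℕ.+ 4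

  nNum≡ : nNum κ ≡ evalℕ orderᴾ m ℕ.* 3125
  nNum≡ = solve 1 (λ m → let k = con 5 :* m :+ con 4 in
    con 512 :* k :* k :* k :* k :* k :+ con 1280 :* k :* k :* k :* k :+ con 6400 :* k :* k :* k
      :+ con 8640 :* k :* k :+ con 6890 :* k :+ con 757
    := horner orderᴾ m :* con 3125) refl m

  g2Num≡ : g2Num κ ≡ lookup (generators m) y₂ ℕ.* 125
  g2Num≡ = solve 1 (λ m → let k = con 5 :* m :+ con 4 in
    con 32 :* k :* k :* k :+ con 56 :* k :* k :+ con 316 :* k :+ con 167
    := horner (lookup generatorsᴾ y₂) m :* con 125) refl m

  g3Num≡ : g3Num κ ≡ lookup (generators m) y₃ ℕ.* 625
  g3Num≡ = solve 1 (λ m → let k = con 5 :* m :+ con 4 in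
    con 128 :* k :* k :* k :* k :+ con 192 :* k :* k :* k :+ con 1408 :* k :* k :+ con 1002 :* k :+ con 908
    := horner (lookup generatorsᴾ y₃) m :* con 625) refl m

  g4Num≡ : g4Num κ ≡ lookup (generators m) y₄ ℕ.* 625
  g4Num≡ = solve 1 (λ m → let k = con 5 :* m :+ con 4 in
    con 128 :* k :* k :* k :* k :+ con 352 :* k :* k :* k :+ con 1488 :* k :* k :+ con 2432 :* k :+ con 543
    := horner (lookup generatorsᴾ y₄) m :* con 625) refl m

  g5Num≡ : g5Num κ ≡ lookup (generators m) y₅ ℕ.* 625
  g5Num≡ = solve 1 (λ m → let k = con 5 :* m :+ con 4 in
    con 256 :* k :* k :* k :* k :+ con 384 :* k :* k :* k :+ con 2616 :* k :* k :+ con 1354 :* k :+ con 116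
    := horner (lookup generatorsᴾ y₅) m :* con 625) refl m

exact : ∀ {a q} d .{{_ : ℕ.NonZero d}} → a ≡ q ℕ.* d → q ≡ a ℕ./ d
exact {q = q} d eq = sym (trans (cong (ℕ._/ d) eq) (ℕ.m*n/n≡m q d))

gens≡ : ∀ m → toList (generators m) ≡ gens (5 ℕ.* m ℕ.+ 4)
gens≡ m = cong₂ _∷_ (cong (ℕ._+ 1) (ℕ.*-zeroʳ m)) (cong₂ _∷_ (exact 125 (g2Num≡ m)) (cong₂ _∷_ (exact 625 (g3Num≡ m))
  (cong₂ _∷_ (exact 625 (g4Num≡ m)) (cong₂ _∷_ (exact 625 (g5Num≡ m)) refl))))

theorem9 : (m : ℕ) → let k = 5 ℕ.* m ℕ.+ 4 in
    (3125 ℕ.∣ nNum k) × (125 ℕ.∣ g2Num k) × (625 ℕ.∣ g3Num k) × (625 ℕ.∣ g4Num k)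
    × (625 ℕ.∣ g5Num k)
    × HasDiameter (L-CC10 k) (gens k) k
theorem9 m = ℕ.divides (evalℕ orderᴾ m) (nNum≡ m)
  , ℕ.divides (lookup (generators m) y₂) (g2Num≡ m)
  , ℕ.divides (lookup (generators m) y₃) (g3Num≡ m)
  , ℕ.divides (lookup (generators m) y₄) (g4Num≡ m)
  , ℕ.divides (lookup (generators m) y₅) (g5Num≡ m)
  , subst₂ (λ n S → HasDiameter n S (5 ℕ.* m ℕ.+ 4)) (trans (sym (order≡ m)) (exact 3125 (nNum≡ m))) (gens≡ m) (hasDiameter m)
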